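{- If two different active pairs clash in an interaction system, then the interaction system is not strongly upward confluent.
   Context: Interaction calculus. A signature $\Sigma$ is a set of agent types, each $\alpha\in\Sigma$ with an arity $\operatorname{ar}(\alpha)\ge 0$. Terms are given by $t ::= x \mid \alpha(t_1,\dots,t_n)$ with $x$ a name and $n=\operatorname{ar}(\alpha)$. An equation $t=u$ is an unordered pair of terms. A configuration $\langle \vec f \mid \Delta\rangle$ consists of a finite sequence of terms $\vec f$ (the interface) and a finite unordered multiset $\Delta$ of equations, where each name occurs at most twice in the whole configuration; configurations are considered up to $\alpha$-conversion (simultaneous renaming of both occurrences of a name to a name not otherwise occurring). An interaction rule is written $\alpha[v_1,\dots,v_m]\bowtie\beta[w_1,\dots,w_n]$ with $m=\operatorname{ar}(\alpha)$, $n=\operatorname{ar}(\beta)$ and $v_i,w_j$ terms in which each name of the rule occurs exactly twice; rules are taken up to renaming of names, $\alpha[\vec v]\bowtie\beta[\vec w]$ is the same rule as $\beta[\vec w]\bowtie\alpha[\vec v]$, and there is at most one rule for each unordered pair of agent types. An interaction system is a signature with a set of interaction rules. If $\alpha[v_1,\dots,v_m]\bowtie\beta[w_1,\dots,w_n]$ is a rule, then $\alpha(t_1,\dots,t_m)\div\beta(u_1,\dots,u_n)$ denotes the multiset of equations $\{t_1=v_1,\dots,t_m=v_m,\ u_1=w_1,\dots,u_n=w_n\}$, where the rule's names may be renamed as in $\alpha$-conversion. An active pair is an equation $\alpha(\vec t)=\beta(\vec u)$ for which the system has a rule $\alpha[\vec v]\bowtie\beta[\vec w]$. Two active pairs $\alpha(\vec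 t)=\beta(\vec u)$ and $\alpha'(\vec{t'})=\beta'(\vec{u'})$ clash if and only if $\alpha(\vec t)\div\beta(\vec u)=\alpha'(\vec{t'})\div\beta'(\vec{u'})\neq\varnothing$. Reduction $\rightarrow$ on configurations consists of two kinds of steps. Interaction: $\langle \vec f \mid \alpha(\vec t)=\beta(\vec u),\ \Delta\rangle \rightarrow \langle \vec f \mid \alpha(\vec t)\div\beta(\vec u),\ \Delta\rangle$ for a rule $\alpha[\vec v]\bowtie\beta[\vec w]$ of the system (with the rule's names chosen fresh for the configuration). Indirection: if a configuration contains an equation $x=u$ where the name $x$ does not occur in $u$ and has its other occurrence elsewhere (in the interface or in another equation), remove the equation $x=u$ and replace the other occurrence of $x$ by $u$; substitution in the interface is included. An interaction system is strongly upward confluent if and only if for all configurations $s_1,s_2,s$ with $s_1\rightarrow s$ and $s_2\rightarrow s$ there exists a configuration $s'$ with $s'\rightarrow s_1$ and $s'\rightarrow s_2$ (single reduction steps). -}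

module Defs where

open import Data.List using (List; []; _∷_; _++_; concatMap; filter; length; map)
open import Data.List.Relation.Binary.Disjoint.Propositional using (Disjoint)
open import Data.List.Relation.Binary.Permutation.Homogeneous using (Permutation)
open import Data.List.Membership.Propositional using (_∉_)
open import Data.Nat using (ℕ; _≤_; _≟_)
open import Data.Product using (Σ-syntax; ∃-syntax; _×_)
open import Data.Sum using (_⊎_)
open import Data.Vec using (Vec; []; _∷_; toList; zipWith)
open import Function using (_∘_)
open import Relation.Binary.Construct.Closure.Equivalence using (EqClosure)
open import Relation.Binary.PropositionalEquality using (_≡_; _≢_)
open import Relation.Nullary using (¬_; yes; no)

Name : Set
Name = ℕ

occurrences : Name → List Name → ℕ
occurrences x = length ∘ filter (x ≟_)

record Signature : Set₁ where
  field
    Agent : Set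
    ar    : Agent → ℕ

open Signature

data Term (𝕊 : Signature) : Set where
  var   : Name → Term 𝕊
  agent : (α : Agent 𝕊) → Vec (Term 𝕊) (ar 𝕊 α) → Term 𝕊

infix 5 _≐_

-- Equations are unordered: they are only ever compared up to _≃_ below.
record Equation (𝕊 : Signature) : Set where
  constructor _≐_
  field
    lhs rhs : Term 𝕊

record PreConfiguration (𝕊 : Signature) : Set where
  constructor ⟨_∣_⟩
  field
    interface : List (Term 𝕊)
    equations : List (Equation 𝕊)

record Rule (𝕊 : Signature) : Set where
  constructor _[_]⋈_[_]
  field
    left       : Agent 𝕊
    leftTerms  : Vec (Term 𝕊) (ar 𝕊 left)
    right      : Agent 𝕊
    rightTerms : Vec (Term 𝕊) (ar 𝕊 right)

open Rule

private variable
  𝕊 : Signature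
  m n : ℕ

names    : Term 𝕊 → List Name
namesVec : Vec (Term 𝕊) n → List Name

names (var x)      = x ∷ []
names (agent _ ts) = namesVec ts

namesVec []       = []
namesVec (t ∷ ts) = names t ++ namesVec ts

namesEq : Equation 𝕊 → List Name
namesEq (t ≐ u) = names t ++ names u

namesConf : PreConfiguration 𝕊 → List Name
namesConf ⟨ f ∣ Δ ⟩ = concatMap names f ++ concatMap namesEq Δ

namesRule : Rule 𝕊 → List Name
namesRule (_ [ vs ]⋈ _ [ ws ]) = namesVec vs ++ namesVec ws

subst    : Name → Term 𝕊 → Term 𝕊 → Term 𝕊
substVec : Name → Term 𝕊 → Vec (Term 𝕊) n → Vec (Term 𝕊) n

subst x u (var y) with x ≟ y
... | yes _ = u
... | no  _ = var y
subst x u (agent α ts) = agent α (substVec x u ts)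

substVec x u []       = []
substVec x u (t ∷ ts) = subst x u t ∷ substVec x u ts

substEq : Name → Term 𝕊 → Equation 𝕊 → Equation 𝕊
substEq x u (t ≐ t′) = subst x u t ≐ subst x u t′

substConf : Name → Term 𝕊 → PreConfiguration 𝕊 → PreConfiguration 𝕊
substConf x u ⟨ f ∣ Δ ⟩ = ⟨ map (subst x u) f ∣ map (substEq x u) Δ ⟩

substRule : Name → Term 𝕊 → Rule 𝕊 → Rule 𝕊
substRule x u (α [ vs ]⋈ β [ ws ]) = α [ substVec x u vs ]⋈ β [ substVec x u ws ]

data _≃_ {𝕊 : Signature} : Equation 𝕊 → Equation 𝕊 → Set where
  same : ∀ {t u} → (t ≐ u) ≃ (t ≐ u)
  flip : ∀ {t u} → (t ≐ u) ≃ (u ≐ t)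

-- The requirement of two occurrences keeps free names fixed.
data _∼_ {𝕊 : Signature} : PreConfiguration 𝕊 → PreConfiguration 𝕊 → Set where
  reorder : ∀ {f Δ Δ′} → Permutation _≃_ Δ Δ′ → ⟨ f ∣ Δ ⟩ ∼ ⟨ f ∣ Δ′ ⟩
  rename  : ∀ {c} x y →
            occurrences x (namesConf c) ≡ 2 → y ∉ namesConf c →
            c ∼ substConf x (var y) c

infix 4 _≈_ _≈ʳ_

_≈_ : PreConfiguration 𝕊 → PreConfiguration 𝕊 → Set
_≈_ = EqClosure _∼_

data _∼ʳ_ {𝕊 : Signature} : Rule 𝕊 → Rule 𝕊 → Set where
  flip   : ∀ {α vs β ws} → (α [ vs ]⋈ β [ ws ]) ∼ʳ (β [ ws ]⋈ α [ vs ])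
  rename : ∀ {r} x y →
           occurrences x (namesRule r) ≡ 2 → y ∉ namesRule r →
           r ∼ʳ substRule x (var y) r

_≈ʳ_ : Rule 𝕊 → Rule 𝕊 → Set
_≈ʳ_ = EqClosure _∼ʳ_

SameAgents : Rule 𝕊 → Rule 𝕊 → Set
SameAgents r r′ = (left r ≡ left r′ × right r ≡ right r′)
                ⊎ (left r ≡ right r′ × right r ≡ left r′)

-- Rules are taken up to _≈ʳ_, so isRule may hold of any nonempty collection
-- of representatives of a rule.
record InteractionSystem (𝕊 : Signature) : Set₁ where
  field
    isRule : Rule 𝕊 → Set
    twice  : ∀ {r x} → isRule r →
             x ∉ namesRule r ⊎ occurrences x (namesRule r) ≡ 2
    unique : ∀ {r r′} → isRule r → isRule r′ → SameAgents r r′ → r ≈ʳ r′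

open InteractionSystem

_∋_ : InteractionSystem 𝕊 → Rule 𝕊 → Set
S ∋ r = ∃[ r₀ ] isRule S r₀ × r₀ ≈ʳ r

pairUp : Vec (Term 𝕊) m → Vec (Term 𝕊) m → Vec (Term 𝕊) n → Vec (Term 𝕊) n →
         List (Equation 𝕊)
pairUp ts vs us ws = toList (zipWith _≐_ ts vs) ++ toList (zipWith _≐_ us ws)

-- An equation standing alone must be able to occur in a configuration, hence
-- the bound on the occurrences of each name.
record ActivePair (S : InteractionSystem 𝕊) : Set where
  field
    α β    : Agent 𝕊
    ts     : Vec (Term 𝕊) (ar 𝕊 α)
    us     : Vec (Term 𝕊) (ar 𝕊 β)
    linear : ∀ x → occurrences x (namesVec ts ++ namesVec us) ≤ 2
    rule   : ∃[ vs ] ∃[ ws ] S ∋ (α [ vs ]⋈ β [ ws ])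

  equation : Equation 𝕊
  equation = agent α ts ≐ agent β us

module _ {S : InteractionSystem 𝕊} where

  -- p ÷↦ Δ: Δ is α(ts) ÷ β(us), for some choice of the names of the rule away
  -- from those of p (and, when α ≡ β, of the orientation of the rule).
  _÷↦_ : ActivePair S → List (Equation 𝕊) → Set
  p ÷↦ Δ =
    Σ[ vs ∈ Vec (Term 𝕊) (ar 𝕊 α) ] Σ[ ws ∈ Vec (Term 𝕊) (ar 𝕊 β) ]
      S ∋ (α [ vs ]⋈ β [ ws ])
      × Disjoint (namesRule (α [ vs ]⋈ β [ ws ])) (namesEq equation)
      × Δ ≡ pairUp ts vs us ws
    where open ActivePair p

  -- Like configurations, lone equations and multisets of equations are
  -- compared up to the names that occur twice in them.
  Different : ActivePair S → ActivePair S → Set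
  Different p q = ¬ (⟨ [] ∣ ActivePair.equation p ∷ [] ⟩ ≈ ⟨ [] ∣ ActivePair.equation q ∷ [] ⟩)

  Clash : ActivePair S → ActivePair S → Set
  Clash p q = ∃[ Δ ] ∃[ Δ′ ]
    p ÷↦ Δ × q ÷↦ Δ′ × ⟨ [] ∣ Δ ⟩ ≈ ⟨ [] ∣ Δ′ ⟩ × Δ ≢ []

data Step (S : InteractionSystem 𝕊) : PreConfiguration 𝕊 → PreConfiguration 𝕊 → Set where
  interaction :
    ∀ {f Δ α β ts us vs ws} →
    S ∋ (α [ vs ]⋈ β [ ws ]) →
    Disjoint (namesRule (α [ vs ]⋈ β [ ws ]))
             (namesConf ⟨ f ∣ (agent α ts ≐ agent β us) ∷ Δ ⟩) →
    Step S ⟨ f ∣ (agent α ts ≐ agent β us) ∷ Δ ⟩ ⟨ f ∣ pairUp ts vs us ws ++ Δ ⟩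
  indirection :
    ∀ {f Δ x u} →
    x ∉ names u →
    occurrences x (namesConf ⟨ f ∣ Δ ⟩) ≡ 1 →
    Step S ⟨ f ∣ (var x ≐ u) ∷ Δ ⟩ (substConf x u ⟨ f ∣ Δ ⟩)

record Configuration (𝕊 : Signature) : Set where
  field
    pre    : PreConfiguration 𝕊
    linear : ∀ x → occurrences x (namesConf pre) ≤ 2

open Configuration

_⊢_⟶_ : InteractionSystem 𝕊 → Configuration 𝕊 → Configuration 𝕊 → Set
S ⊢ s ⟶ s′ = ∃[ c ] ∃[ c′ ] pre s ≈ c × Step S c c′ × c′ ≈ pre s′

StronglyUpwardConfluent : InteractionSystem 𝕊 → Set
StronglyUpwardConfluent {𝕊} S =
  ∀ (s₁ s₂ s : Configuration 𝕊) → S ⊢ s₁ ⟶ s → S ⊢ s₂ ⟶ s →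
  Σ[ s′ ∈ Configuration 𝕊 ] S ⊢ s′ ⟶ s₁ × S ⊢ s′ ⟶ s₂

{-# OPTIONS --safe #-}
module Submission where

-- Let ⟨ p ⟩ and ⟨ q ⟩ be the configurations consisting of one active pair each;
-- by the clash they reduce to a common configuration.  Conversely, if s reduces
-- to both of them, they are α-equivalent: up to α-equivalence both steps start
-- from the same s.  An interaction leaves one equation per port, and the ports of
-- p and q exist because their reduct is nonempty, so s has at most two equations
-- and the two steps can neither be of different kinds nor interact at different
-- equations.  Two interactions at the same equation agree because there is one
-- rule per pair of agents.  Two indirections at different equations, or at
-- different sides of one equation, also agree: x = u, x = v reduces to u = v
-- either way, and eliminating x or y by x = y gives the same result up to renaming.

open import Defs
open import Data.Empty using (⊥)
open import Data.List using (List; []; _∷_; _++_; concatMap; filter; length; map)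
open import Data.List.Extrema.Nat using (max; xs≤max)
open import Data.List.Membership.Propositional using (_∈_; _∉_)
open import Data.List.Membership.Propositional.Properties
  using (∈-map⁺; ∈-map⁻; ∈-++⁺ˡ; ∈-++⁺ʳ; ∈-++⁻)
open import Data.List.Properties
  using (map-∘; map-cong; map-id; map-++; concatMap-++; filter-++; filter-accept;
         filter-reject; length-++; length-map; ++-identityʳ; ∷ʳ-injectiveʳ)
open import Data.List.Relation.Binary.Disjoint.Propositional using (Disjoint)
open import Data.List.Relation.Binary.Permutation.Homogeneous as Perm
  using (Permutation; prep; trans; refl; swap)
import Data.List.Relation.Binary.Permutation.Setoid.Properties as SetoidPermutation
open import Data.List.Relation.Binary.Pointwise as Pointwise using (Pointwise; []; _∷_)
open import Data.List.Relation.Unary.All using (lookup)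
open import Data.List.Relation.Unary.Any using (here; there)
open import Data.Nat
open import Data.Nat.Properties
open import Data.List.Membership.DecPropositional _≟_ using (_∈?_)
open import Algebra.Properties.CommutativeSemigroup +-commutativeSemigroup
  using (x∙yz≈y∙xz; interchange)
open import Data.Nat.Solver using (module +-*-Solver)
open import Data.Product using (∃-syntax; _×_; _,_)
open import Data.Sum using (_⊎_; inj₁; inj₂)
open import Data.Vec using (Vec; []; _∷_; toList; zipWith)
open import Function using (_∘_; id)
open import Function.Definitions using (Injective)
open import Relation.Binary using (Setoid)
open import Relation.Binary.Construct.Closure.Equivalence as EqClosure using ()
open import Relation.Binary.Construct.Closure.ReflexiveTransitive using (ε; _◅_; _◅◅_)
open import Relation.Binary.Construct.Closure.Symmetric using (fwd; bwd)
open import Relation.Binary.PropositionalEquality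
  using (_≡_; _≢_; cong; cong₂; sym)
  renaming (refl to ≡-refl; trans to ≡-trans; subst to ≡-subst)
open import Relation.Nullary using (¬_; yes; no; contradiction)

open Signature

private variable
  𝕊 : Signature
  m n : ℕ

-- Occurrences of names

occurrences-++ : ∀ x ys zs →
  occurrences x (ys ++ zs) ≡ occurrences x ys + occurrences x zs
occurrences-++ x ys zs = ≡-trans (cong length (filter-++ (x ≟_) ys zs)) (length-++ (filter (x ≟_) ys))

occurrences-here : ∀ x ys → occurrences x (x ∷ ys) ≡ suc (occurrences x ys)
occurrences-here x ys = cong length (filter-accept (x ≟_) ≡-refl)

occurrences-there : ∀ {x y} ys → x ≢ y → occurrences x (y ∷ ys) ≡ occurrences x ys
occurrences-there {x} ys x≢y = cong length (filter-reject (x ≟_) x≢y)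

occurrences-∉ : ∀ {x} ys → x ∉ ys → occurrences x ys ≡ 0
occurrences-∉ [] _ = ≡-refl
occurrences-∉ (y ∷ ys) x∉ =
  ≡-trans (occurrences-there ys (λ { ≡-refl → x∉ (here ≡-refl) })) (occurrences-∉ ys (x∉ ∘ there))

occurrences≢0 : ∀ {x ys} → x ∈ ys → occurrences x ys ≢ 0
occurrences≢0 {x} {y ∷ ys} (here ≡-refl) eq with () ← ≡-trans (sym (occurrences-here x ys)) eq
occurrences≢0 {x} {y ∷ ys} (there x∈ys) eq with x ≟ y
... | yes ≡-refl with () ← ≡-trans (sym (occurrences-here x ys)) eq
... | no x≢y = occurrences≢0 x∈ys (≡-trans (sym (occurrences-there ys x≢y)) eq)

-- Reorderings and reduction steps are followed below only through the number of occurrences of each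
-- name; this recovers membership from such counts.
∈-occurrences : ∀ {x xs ys} → occurrences x xs ≡ occurrences x ys → x ∈ xs → x ∈ ys
∈-occurrences {x} {xs} {ys} eq x∈xs with x ∈? ys
... | yes x∈ys = x∈ys
... | no  x∉ys = contradiction (≡-trans eq (occurrences-∉ ys x∉ys)) (occurrences≢0 x∈xs)

-- Renaming names that occur twice

InjectiveOn : (Name → Name) → List Name → Set
InjectiveOn ρ xs = ∀ {x y} → x ∈ xs → y ∈ xs → ρ x ≡ ρ y → x ≡ y

-- Only collisions of x with entries of `ys` can change the count. Stated this way it also applies
-- to `x ↦ y`, which is not injective on all names.
occurrences-map : ∀ {ρ x} ys → (∀ {y} → y ∈ ys → ρ x ≡ ρ y → x ≡ y) →
  occurrences (ρ x) (map ρ ys) ≡ occurrences x ys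
occurrences-map [] _ = ≡-refl
occurrences-map {ρ} {x} (y ∷ ys) inj with x ≟ y
... | yes ≡-refl =
  ≡-trans (occurrences-here (ρ x) (map ρ ys))
    (≡-trans (cong suc (occurrences-map ys (inj ∘ there))) (sym (occurrences-here x ys)))
... | no x≢y =
  ≡-trans (occurrences-there (map ρ ys) (x≢y ∘ inj (here ≡-refl)))
    (≡-trans (occurrences-map ys (inj ∘ there)) (sym (occurrences-there ys x≢y)))

infix 6 _↦_

_↦_ : Name → Name → Name → Name
(x ↦ y) z with x ≟ z
... | yes _ = y
... | no  _ = z

↦-same : ∀ x y → (x ↦ y) x ≡ y
↦-same x y with x ≟ x
... | yes _  = ≡-refl
... | no x≢x = contradiction ≡-refl x≢x

↦-other : ∀ {x y z} → x ≢ z → (x ↦ y) z ≡ z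
↦-other {x} {y} {z} x≢z with x ≟ z
... | yes x≡z = contradiction x≡z x≢z
... | no _    = ≡-refl

-- A name that occurs only once is free, and α-conversion must leave it fixed.
MovesOnlyTwice : (Name → Name) → List Name → Set
MovesOnlyTwice ρ xs = ∀ {z} → z ∈ xs → ρ z ≡ z ⊎ occurrences z xs ≡ 2

-- The argument is the same for configurations and for rules, so it is carried out once over an
-- abstract carrier and instantiated for both.
module Renaming
  {X : Set} (namesOf : X → List Name) (rename : (Name → Name) → X → X)
  (names-rename : ∀ ρ c → namesOf (rename ρ c) ≡ map ρ (namesOf c))
  (rename-cong  : ∀ {ρ σ} c → (∀ {z} → z ∈ namesOf c → ρ z ≡ σ z) → rename ρ c ≡ rename σ c)
  (rename-∘     : ∀ ρ σ c → rename ρ (rename σ c) ≡ rename (ρ ∘ σ) c)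
  (rename-id    : ∀ c → rename id c ≡ c)
  (_≅_ : X → X → Set)
  (≅-refl  : ∀ {c} → c ≅ c)
  (≅-sym   : ∀ {c d} → c ≅ d → d ≅ c)
  (≅-trans : ∀ {c d e} → c ≅ d → d ≅ e → c ≅ e)
  (≅-rename : ∀ {c} x y → occurrences x (namesOf c) ≡ 2 → y ∉ namesOf c → c ≅ rename (x ↦ y) c)
  where

  ≅-reflexive : ∀ {c d} → c ≡ d → c ≅ d
  ≅-reflexive ≡-refl = ≅-refl

  ∈-rename : ∀ ρ c {z} → z ∈ namesOf c → ρ z ∈ namesOf (rename ρ c)
  ∈-rename ρ c z∈ rewrite names-rename ρ c = ∈-map⁺ ρ z∈

  ∈-rename⁻ : ∀ ρ c {w} → w ∈ namesOf (rename ρ c) → ∃[ z ] z ∈ namesOf c × w ≡ ρ z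
  ∈-rename⁻ ρ c w∈ rewrite names-rename ρ c = ∈-map⁻ ρ w∈

  -- The names to be moved, listed in xs, can be renamed one at a time because their
  -- images are fresh.
  ≅-rename-fresh : ∀ xs ρ c →
    InjectiveOn ρ (namesOf c) →
    (∀ {z} → z ∈ namesOf c → ρ (ρ z) ≡ ρ z) →
    (∀ {z} → z ∈ namesOf c → ρ z ≡ z ⊎ (occurrences z (namesOf c) ≡ 2 × ρ z ∉ namesOf c)) →
    (∀ {z} → z ∈ namesOf c → ρ z ≡ z ⊎ z ∈ xs) →
    c ≅ rename ρ c
  ≅-rename-fresh [] ρ c _ _ _ listed = ≅-reflexive (sym (≡-trans (rename-cong c fixed) (rename-id c)))
    where
    fixed : ∀ {z} → z ∈ namesOf c → ρ z ≡ z
    fixed z∈ with inj₁ eq ← listed z∈ = eq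
  ≅-rename-fresh (x ∷ xs) ρ c inj idem moves listed with x ∈? (namesOf c)
  ... | no x∉ = ≅-rename-fresh xs ρ c inj idem moves skip
    where
    skip : ∀ {z} → z ∈ namesOf c → ρ z ≡ z ⊎ z ∈ xs
    skip z∈ with listed z∈
    ... | inj₁ eq = inj₁ eq
    ... | inj₂ (here ≡-refl) = contradiction z∈ x∉
    ... | inj₂ (there z∈xs) = inj₂ z∈xs
  ... | yes x∈ with moves x∈
  ... | inj₁ ρx≡x = ≅-rename-fresh xs ρ c inj idem moves skip
    where
    skip : ∀ {z} → z ∈ namesOf c → ρ z ≡ z ⊎ z ∈ xs
    skip z∈ with listed z∈
    ... | inj₁ eq = inj₁ eq
    ... | inj₂ (here ≡-refl) = inj₁ ρx≡x
    ... | inj₂ (there z∈xs) = inj₂ z∈xs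
  -- Rename x alone, then use induction on the result `c₁`. Idempotence makes ρ fix the new name ρ
  -- x, so applying ρ to `c₁` still gives what ρ makes of c.
  ... | inj₂ (x-twice , ρx∉) =
    ≅-trans (≅-rename x (ρ x) x-twice ρx∉)
      (≅-trans (≅-rename-fresh xs ρ c₁ inj-c₁ idem₁ moves₁ listed₁)
        (≅-reflexive (≡-trans (rename-∘ ρ τ c) (rename-cong c ρτ≡ρ))))
    where
    τ = x ↦ ρ x
    c₁ = rename τ c

    ρτ≡ρ : ∀ {z} → z ∈ namesOf c → ρ (τ z) ≡ ρ z
    ρτ≡ρ {z} z∈ with x ≟ z
    ... | yes ≡-refl = idem z∈
    ... | no _       = ≡-refl

    inj-c₁ : InjectiveOn ρ (namesOf c₁)
    inj-c₁ w∈ w′∈ eq with ∈-rename⁻ τ c w∈ | ∈-rename⁻ τ c w′∈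
    ... | z , z∈ , ≡-refl | z′ , z′∈ , ≡-refl =
      cong τ (inj z∈ z′∈ (≡-trans (sym (ρτ≡ρ z∈)) (≡-trans eq (ρτ≡ρ z′∈))))

    idem₁ : ∀ {w} → w ∈ namesOf c₁ → ρ (ρ w) ≡ ρ w
    idem₁ w∈ with ∈-rename⁻ τ c w∈
    ... | z , z∈ , ≡-refl = ≡-trans (cong ρ (ρτ≡ρ z∈)) (≡-trans (idem z∈) (sym (ρτ≡ρ z∈)))

    occurrences-c₁ : ∀ {z} → z ∈ namesOf c → x ≢ z →
      occurrences z (namesOf c₁) ≡ occurrences z (namesOf c)
    occurrences-c₁ {z} z∈ x≢z rewrite names-rename τ c =
      ≡-trans (cong (λ w → occurrences w (map τ (namesOf c))) (sym (↦-other x≢z)))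
        (occurrences-map (namesOf c) τ-inj)
      where
      τ-inj : ∀ {y} → y ∈ namesOf c → τ z ≡ τ y → z ≡ y
      τ-inj {y} y∈ eq rewrite ↦-other {y = ρ x} x≢z with x ≟ y
      ... | yes ≡-refl = contradiction (≡-subst (_∈ namesOf c) eq z∈) ρx∉
      ... | no _       = eq

    moves₁ : ∀ {w} → w ∈ namesOf c₁ → ρ w ≡ w ⊎ (occurrences w (namesOf c₁) ≡ 2 × ρ w ∉ namesOf c₁)
    moves₁ w∈ with ∈-rename⁻ τ c w∈
    ... | z , z∈ , ≡-refl with x ≟ z
    ... | yes ≡-refl = inj₁ (idem x∈)
    ... | no x≢z with moves z∈
    ... | inj₁ eq = inj₁ eq
    ... | inj₂ (z-twice , ρz∉) = inj₂ (≡-trans (occurrences-c₁ z∈ x≢z) z-twice , ρz∉₁)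
      where
      ρz∉₁ : ρ z ∉ namesOf c₁
      ρz∉₁ ρz∈ with ∈-rename⁻ τ c ρz∈
      ... | y , y∈ , eq with x ≟ y
      ... | yes ≡-refl = x≢z (sym (inj z∈ x∈ eq))
      ... | no _       = ρz∉ (≡-subst (_∈ namesOf c) (sym eq) y∈)

    listed₁ : ∀ {w} → w ∈ namesOf c₁ → ρ w ≡ w ⊎ w ∈ xs
    listed₁ w∈ with ∈-rename⁻ τ c w∈
    ... | z , z∈ , ≡-refl with x ≟ z
    ... | yes ≡-refl = inj₁ (idem x∈)
    ... | no x≢z with listed z∈
    ... | inj₁ eq = inj₁ eq
    ... | inj₂ (here ≡-refl) = contradiction ≡-refl x≢z
    ... | inj₂ (there z∈xs) = inj₂ z∈xs

  -- Every moved name is first shifted beyond all the names involved, so that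
  -- both stages rename to fresh names only.
  ≅-rename-injective : ∀ ρ c → InjectiveOn ρ (namesOf c) → MovesOnlyTwice ρ (namesOf c) →
    c ≅ rename ρ c
  ≅-rename-injective ρ c inj moves =
    ≅-trans (≅-rename-fresh (namesOf c) σ c σ-inj σ-idem σ-moves (λ z∈ → inj₂ z∈))
      (≅-trans (≅-rename-fresh (namesOf c₁) θ c₁ θ-inj θ-idem θ-moves (λ z∈ → inj₂ z∈))
        (≅-reflexive (≡-trans (rename-∘ θ σ c) (rename-cong c θσ≡ρ))))
    where
    ns = namesOf c
    -- The 0 is the value of `max` on an empty list; the successor puts all names of c and all their
    -- images strictly below K.
    K = suc (max 0 (ns ++ map ρ ns))

    ns<K : ∀ {z} → z ∈ ns → z < K
    ns<K z∈ = s≤s (lookup (xs≤max 0 (ns ++ map ρ ns)) (∈-++⁺ˡ z∈))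

    ρ<K : ∀ {z} → z ∈ ns → ρ z < K
    ρ<K z∈ = s≤s (lookup (xs≤max 0 (ns ++ map ρ ns)) (∈-++⁺ʳ ns (∈-map⁺ ρ z∈)))

    -- σ shifts the moved names by K, and its test against K makes it fix the names so obtained. θ
    -- undoes the shift and then applies ρ, leaving names below K alone; together they factor ρ.
    σ θ : Name → Name
    σ z with ρ z ≟ z | z <? K
    ... | no _  | yes _ = K + z
    ... | _     | _     = z
    θ w with w <? K
    ... | yes _ = w
    ... | no _  = ρ (w ∸ K)

    c₁ = rename σ c

    K+≮K : ∀ {z} → ¬ (K + z < K)
    K+≮K {z} = <⇒≱ (s≤s (m≤m+n _ z))

    σ-cases : ∀ {z} → z ∈ ns → (ρ z ≡ z × σ z ≡ z) ⊎ (ρ z ≢ z × σ z ≡ K + z)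
    σ-cases {z} z∈ with ρ z ≟ z | z <? K
    ... | yes eq | yes _ = inj₁ (eq , ≡-refl)
    ... | yes eq | no _  = inj₁ (eq , ≡-refl)
    ... | no neq | yes _ = inj₂ (neq , ≡-refl)
    ... | no neq | no z≮K = contradiction (ns<K z∈) z≮K

    σ-idem : ∀ {z} → z ∈ ns → σ (σ z) ≡ σ z
    σ-idem {z} z∈ with σ-cases z∈
    ... | inj₁ (_ , eq) = cong σ eq
    ... | inj₂ (_ , eq) rewrite eq with ρ (K + z) ≟ K + z | K + z <? K
    ... | yes _ | yes _ = ≡-refl
    ... | yes _ | no _  = ≡-refl
    ... | no _  | no _  = ≡-refl
    ... | no _  | yes K+z<K = contradiction K+z<K K+≮K

    θ-small : ∀ {w} → w < K → θ w ≡ w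
    θ-small {w} w<K with w <? K
    ... | yes _  = ≡-refl
    ... | no w≮K = contradiction w<K w≮K

    θ-shifted : ∀ z → θ (K + z) ≡ ρ z
    θ-shifted z with K + z <? K
    ... | yes lt = contradiction lt K+≮K
    ... | no _   = cong ρ (m+n∸m≡n K z)

    θσ≡ρ : ∀ {z} → z ∈ ns → θ (σ z) ≡ ρ z
    θσ≡ρ {z} z∈ with σ-cases z∈
    ... | inj₁ (ρz≡z , eq) rewrite eq = ≡-trans (θ-small (ns<K z∈)) (sym ρz≡z)
    ... | inj₂ (_ , eq)    rewrite eq = θ-shifted z

    -- Since ρ factors through σ, names merged by σ would be merged by ρ.
    σ-inj : InjectiveOn σ ns
    σ-inj z∈ z′∈ eq = inj z∈ z′∈ (≡-trans (sym (θσ≡ρ z∈)) (≡-trans (cong θ eq) (θσ≡ρ z′∈)))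

    σ-moves : ∀ {z} → z ∈ ns → σ z ≡ z ⊎ (occurrences z ns ≡ 2 × σ z ∉ ns)
    σ-moves z∈ with σ-cases z∈
    ... | inj₁ (_ , eq) = inj₁ eq
    ... | inj₂ (ρz≢z , eq) with moves z∈
    ... | inj₁ ρz≡z  = contradiction ρz≡z ρz≢z
    ... | inj₂ twice = inj₂ (twice , λ σz∈ → K+≮K (≡-subst (_< K) eq (ns<K σz∈)))

    θ-inj : InjectiveOn θ (namesOf c₁)
    θ-inj w∈ w′∈ eq with ∈-rename⁻ σ c w∈ | ∈-rename⁻ σ c w′∈
    ... | z , z∈ , ≡-refl | z′ , z′∈ , ≡-refl =
      cong σ (inj z∈ z′∈ (≡-trans (sym (θσ≡ρ z∈)) (≡-trans eq (θσ≡ρ z′∈))))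

    θ-idem : ∀ {w} → w ∈ namesOf c₁ → θ (θ w) ≡ θ w
    θ-idem w∈ with ∈-rename⁻ σ c w∈
    ... | z , z∈ , ≡-refl = θ-small (≡-subst (_< K) (sym (θσ≡ρ z∈)) (ρ<K z∈))

    θ-moves : ∀ {w} → w ∈ namesOf c₁ → θ w ≡ w ⊎ (occurrences w (namesOf c₁) ≡ 2 × θ w ∉ namesOf c₁)
    θ-moves w∈ with ∈-rename⁻ σ c w∈
    ... | z , z∈ , ≡-refl with σ-cases z∈ | moves z∈
    ... | inj₁ (_ , eq) | _ rewrite eq = inj₁ (θ-small (ns<K z∈))
    ... | inj₂ (ρz≢z , _) | inj₁ ρz≡z = contradiction ρz≡z ρz≢z
    ... | inj₂ (ρz≢z , eq) | inj₂ twice = inj₂ (twice₁ , θσz∉)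
      where
      twice₁ : occurrences (σ z) (namesOf c₁) ≡ 2
      twice₁ rewrite names-rename σ c =
        ≡-trans (occurrences-map ns (σ-inj z∈)) twice

      -- The image ρ z lies below K, so it could be present in `c₁` only as an unmoved name y;
      -- injectivity of ρ then gives y = z, although z is moved.
      θσz∉ : θ (σ z) ∉ namesOf c₁
      θσz∉ ∈₁ with ∈-rename⁻ σ c (≡-subst (_∈ namesOf c₁) (θσ≡ρ z∈) ∈₁)
      ... | y , y∈ , ρz≡σy with σ-cases y∈
      ... | inj₂ (_ , σy≡) = K+≮K (≡-subst (_< K) (≡-trans ρz≡σy σy≡) (ρ<K z∈))
      ... | inj₁ (ρy≡y , σy≡y) with inj z∈ y∈ (≡-trans ρz≡σy (≡-trans σy≡y (sym ρy≡y)))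
      ... | ≡-refl = ρz≢z ρy≡y

-- Simultaneous substitution

-- Replacing one name at a time is not closed under composition. Functions from names to terms are,
-- and they contain the renamings as `var ∘ ρ`.
Substitution : Signature → Set
Substitution 𝕊 = Name → Term 𝕊

bind    : Substitution 𝕊 → Term 𝕊 → Term 𝕊
bindVec : Substitution 𝕊 → Vec (Term 𝕊) n → Vec (Term 𝕊) n

bind g (var x)      = g x
bind g (agent α ts) = agent α (bindVec g ts)

bindVec g []       = []
bindVec g (t ∷ ts) = bind g t ∷ bindVec g ts

bindEq : Substitution 𝕊 → Equation 𝕊 → Equation 𝕊
bindEq g (t ≐ u) = bind g t ≐ bind g u

bindConf : Substitution 𝕊 → PreConfiguration 𝕊 → PreConfiguration 𝕊
bindConf g ⟨ f ∣ Δ ⟩ = ⟨ map (bind g) f ∣ map (bindEq g) Δ ⟩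

bindRule : Substitution 𝕊 → Rule 𝕊 → Rule 𝕊
bindRule g (α [ vs ]⋈ β [ ws ]) = α [ bindVec g vs ]⋈ β [ bindVec g ws ]

_≔_ : Name → Term 𝕊 → Substitution 𝕊
(x ≔ u) y with x ≟ y
... | yes _ = u
... | no  _ = var y

≔-var : ∀ {𝕊} x y z → (_≔_ {𝕊} x (var y)) z ≡ var ((x ↦ y) z)
≔-var x y z with x ≟ z
... | yes _ = ≡-refl
... | no _  = ≡-refl

subst≡bind    : ∀ x (u : Term 𝕊) t → subst x u t ≡ bind (x ≔ u) t
substVec≡bind : ∀ x (u : Term 𝕊) (ts : Vec (Term 𝕊) n) → substVec x u ts ≡ bindVec (x ≔ u) ts

subst≡bind x u (var y) with x ≟ y
... | yes _ = ≡-refl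
... | no _  = ≡-refl
subst≡bind x u (agent α ts) = cong (agent α) (substVec≡bind x u ts)

substVec≡bind x u []       = ≡-refl
substVec≡bind x u (t ∷ ts) = cong₂ _∷_ (subst≡bind x u t) (substVec≡bind x u ts)

substEq≡bind : ∀ x (u : Term 𝕊) e → substEq x u e ≡ bindEq (x ≔ u) e
substEq≡bind x u (t ≐ t′) = cong₂ _≐_ (subst≡bind x u t) (subst≡bind x u t′)

substConf≡bind : ∀ x (u : Term 𝕊) c → substConf x u c ≡ bindConf (x ≔ u) c
substConf≡bind x u ⟨ f ∣ Δ ⟩ =
  cong₂ ⟨_∣_⟩ (map-cong (subst≡bind x u) f) (map-cong (substEq≡bind x u) Δ)

substRule≡bind : ∀ x (u : Term 𝕊) r → substRule x u r ≡ bindRule (x ≔ u) r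
substRule≡bind x u (α [ vs ]⋈ β [ ws ]) =
  cong₂ (α [_]⋈ β [_]) (substVec≡bind x u vs) (substVec≡bind x u ws)

names-bind    : ∀ g (t : Term 𝕊) → names (bind g t) ≡ concatMap (names ∘ g) (names t)
names-bindVec : ∀ g (ts : Vec (Term 𝕊) n) →
  namesVec (bindVec g ts) ≡ concatMap (names ∘ g) (namesVec ts)

names-bind g (var x)      = sym (++-identityʳ (names (g x)))
names-bind g (agent α ts) = names-bindVec g ts

names-bindVec g []       = ≡-refl
names-bindVec g (t ∷ ts) =
  ≡-trans (cong₂ _++_ (names-bind g t) (names-bindVec g ts))
    (sym (concatMap-++ (names ∘ g) (names t) (namesVec ts)))

names-bindEq : ∀ g (e : Equation 𝕊) → namesEq (bindEq g e) ≡ concatMap (names ∘ g) (namesEq e)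
names-bindEq g (t ≐ u) =
  ≡-trans (cong₂ _++_ (names-bind g t) (names-bind g u))
    (sym (concatMap-++ (names ∘ g) (names t) (names u)))

concatMap-map-commute : ∀ {A B : Set} (N : A → List B) (h : A → A) (g : B → List B) →
  (∀ a → N (h a) ≡ concatMap g (N a)) →
  ∀ xs → concatMap N (map h xs) ≡ concatMap g (concatMap N xs)
concatMap-map-commute N h g eq []       = ≡-refl
concatMap-map-commute N h g eq (x ∷ xs) =
  ≡-trans (cong₂ _++_ (eq x) (concatMap-map-commute N h g eq xs))
    (sym (concatMap-++ g (N x) (concatMap N xs)))

names-bindConf : ∀ g (c : PreConfiguration 𝕊) →
  namesConf (bindConf g c) ≡ concatMap (names ∘ g) (namesConf c)
names-bindConf g ⟨ f ∣ Δ ⟩ =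
  ≡-trans (cong₂ _++_ (concatMap-map-commute names (bind g) (names ∘ g) (names-bind g) f)
                      (concatMap-map-commute namesEq (bindEq g) (names ∘ g) (names-bindEq g) Δ))
    (sym (concatMap-++ (names ∘ g) (concatMap names f) (concatMap namesEq Δ)))

names-bindRule : ∀ g (r : Rule 𝕊) →
  namesRule (bindRule g r) ≡ concatMap (names ∘ g) (namesRule r)
names-bindRule g (α [ vs ]⋈ β [ ws ]) =
  ≡-trans (cong₂ _++_ (names-bindVec g vs) (names-bindVec g ws))
    (sym (concatMap-++ (names ∘ g) (namesVec vs) (namesVec ws)))

AgreeOn : Substitution 𝕊 → Substitution 𝕊 → List Name → Set
AgreeOn g h xs = ∀ {x} → x ∈ xs → g x ≡ h x

bind-cong    : ∀ {g h} (t : Term 𝕊) → AgreeOn g h (names t) → bind g t ≡ bind h t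
bindVec-cong : ∀ {g h} (ts : Vec (Term 𝕊) n) → AgreeOn g h (namesVec ts) → bindVec g ts ≡ bindVec h ts

bind-cong (var x)      agree = agree (here ≡-refl)
bind-cong (agent α ts) agree = cong (agent α) (bindVec-cong ts agree)

bindVec-cong []       agree = ≡-refl
bindVec-cong (t ∷ ts) agree =
  cong₂ _∷_ (bind-cong t (agree ∘ ∈-++⁺ˡ)) (bindVec-cong ts (agree ∘ ∈-++⁺ʳ (names t)))

bindEq-cong : ∀ {g h} (e : Equation 𝕊) → AgreeOn g h (namesEq e) → bindEq g e ≡ bindEq h e
bindEq-cong (t ≐ u) agree =
  cong₂ _≐_ (bind-cong t (agree ∘ ∈-++⁺ˡ)) (bind-cong u (agree ∘ ∈-++⁺ʳ (names t)))

map-cong-on : ∀ {A B : Set} (N : A → List Name) {h k : A → B} {P : Name → Set} →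
  (∀ a → (∀ {x} → x ∈ N a → P x) → h a ≡ k a) →
  ∀ xs → (∀ {x} → x ∈ concatMap N xs → P x) → map h xs ≡ map k xs
map-cong-on N eq []       agree = ≡-refl
map-cong-on N eq (a ∷ xs) agree =
  cong₂ _∷_ (eq a (agree ∘ ∈-++⁺ˡ)) (map-cong-on N eq xs (agree ∘ ∈-++⁺ʳ (N a)))

bindConf-cong : ∀ {g h} (c : PreConfiguration 𝕊) → AgreeOn g h (namesConf c) →
  bindConf g c ≡ bindConf h c
bindConf-cong ⟨ f ∣ Δ ⟩ agree =
  cong₂ ⟨_∣_⟩ (map-cong-on names bind-cong f (agree ∘ ∈-++⁺ˡ))
              (map-cong-on namesEq bindEq-cong Δ (agree ∘ ∈-++⁺ʳ (concatMap names f)))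

bindRule-cong : ∀ {g h} (r : Rule 𝕊) → AgreeOn g h (namesRule r) → bindRule g r ≡ bindRule h r
bindRule-cong (α [ vs ]⋈ β [ ws ]) agree =
  cong₂ (α [_]⋈ β [_]) (bindVec-cong vs (agree ∘ ∈-++⁺ˡ))
                       (bindVec-cong ws (agree ∘ ∈-++⁺ʳ (namesVec vs)))

bind-∘    : ∀ g h (t : Term 𝕊) → bind g (bind h t) ≡ bind (bind g ∘ h) t
bindVec-∘ : ∀ g h (ts : Vec (Term 𝕊) n) → bindVec g (bindVec h ts) ≡ bindVec (bind g ∘ h) ts

bind-∘ g h (var x)      = ≡-refl
bind-∘ g h (agent α ts) = cong (agent α) (bindVec-∘ g h ts)

bindVec-∘ g h []       = ≡-refl
bindVec-∘ g h (t ∷ ts) = cong₂ _∷_ (bind-∘ g h t) (bindVec-∘ g h ts)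

bindEq-∘ : ∀ g h (e : Equation 𝕊) → bindEq g (bindEq h e) ≡ bindEq (bind g ∘ h) e
bindEq-∘ g h (t ≐ u) = cong₂ _≐_ (bind-∘ g h t) (bind-∘ g h u)

bindConf-∘ : ∀ g h (c : PreConfiguration 𝕊) → bindConf g (bindConf h c) ≡ bindConf (bind g ∘ h) c
bindConf-∘ g h ⟨ f ∣ Δ ⟩ =
  cong₂ ⟨_∣_⟩ (≡-trans (sym (map-∘ f)) (map-cong (bind-∘ g h) f))
              (≡-trans (sym (map-∘ Δ)) (map-cong (bindEq-∘ g h) Δ))

bindRule-∘ : ∀ g h (r : Rule 𝕊) → bindRule g (bindRule h r) ≡ bindRule (bind g ∘ h) r
bindRule-∘ g h (α [ vs ]⋈ β [ ws ]) = cong₂ (α [_]⋈ β [_]) (bindVec-∘ g h vs) (bindVec-∘ g h ws)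

bind-var    : ∀ (t : Term 𝕊) → bind var t ≡ t
bindVec-var : ∀ (ts : Vec (Term 𝕊) n) → bindVec var ts ≡ ts

bind-var (var x)      = ≡-refl
bind-var (agent α ts) = cong (agent α) (bindVec-var ts)

bindVec-var []       = ≡-refl
bindVec-var (t ∷ ts) = cong₂ _∷_ (bind-var t) (bindVec-var ts)

bindEq-var : ∀ (e : Equation 𝕊) → bindEq var e ≡ e
bindEq-var (t ≐ u) = cong₂ _≐_ (bind-var t) (bind-var u)

bindConf-var : ∀ (c : PreConfiguration 𝕊) → bindConf var c ≡ c
bindConf-var ⟨ f ∣ Δ ⟩ =
  cong₂ ⟨_∣_⟩ (≡-trans (map-cong bind-var f) (map-id f)) (≡-trans (map-cong bindEq-var Δ) (map-id Δ))

bindRule-var : ∀ (r : Rule 𝕊) → bindRule var r ≡ r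
bindRule-var (α [ vs ]⋈ β [ ws ]) = cong₂ (α [_]⋈ β [_]) (bindVec-var vs) (bindVec-var ws)

concatMap-names-var : ∀ 𝕊 (ρ : Name → Name) xs → concatMap (λ x → names {𝕊} (var (ρ x))) xs ≡ map ρ xs
concatMap-names-var 𝕊 ρ []       = ≡-refl
concatMap-names-var 𝕊 ρ (x ∷ xs) = cong (ρ x ∷_) (concatMap-names-var 𝕊 ρ xs)

-- Renamings as substitutions

renConf : (Name → Name) → PreConfiguration 𝕊 → PreConfiguration 𝕊
renConf ρ = bindConf (var ∘ ρ)

renRule : (Name → Name) → Rule 𝕊 → Rule 𝕊
renRule ρ = bindRule (var ∘ ρ)

names-renConf : ∀ ρ (c : PreConfiguration 𝕊) → namesConf (renConf ρ c) ≡ map ρ (namesConf c)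
names-renConf {𝕊} ρ c = ≡-trans (names-bindConf (var ∘ ρ) c) (concatMap-names-var 𝕊 ρ (namesConf c))

names-renRule : ∀ ρ (r : Rule 𝕊) → namesRule (renRule ρ r) ≡ map ρ (namesRule r)
names-renRule {𝕊} ρ r = ≡-trans (names-bindRule (var ∘ ρ) r) (concatMap-names-var 𝕊 ρ (namesRule r))

substConf≡ren : ∀ x y (c : PreConfiguration 𝕊) → substConf x (var y) c ≡ renConf (x ↦ y) c
substConf≡ren x y c = ≡-trans (substConf≡bind x (var y) c) (bindConf-cong c λ {z} _ → ≔-var x y z)

substRule≡ren : ∀ x y (r : Rule 𝕊) → substRule x (var y) r ≡ renRule (x ↦ y) r
substRule≡ren x y r = ≡-trans (substRule≡bind x (var y) r) (bindRule-cong r λ {z} _ → ≔-var x y z)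

≈-reflexive : {c d : PreConfiguration 𝕊} → c ≡ d → c ≈ d
≈-reflexive ≡-refl = ε

≈-sym : {c d : PreConfiguration 𝕊} → c ≈ d → d ≈ c
≈-sym = EqClosure.symmetric _∼_

≈ʳ-sym : {r r′ : Rule 𝕊} → r ≈ʳ r′ → r′ ≈ʳ r
≈ʳ-sym = EqClosure.symmetric _∼ʳ_

≈-rename : ∀ {c : PreConfiguration 𝕊} x y → occurrences x (namesConf c) ≡ 2 → y ∉ namesConf c →
  c ≈ renConf (x ↦ y) c
≈-rename {c = c} x y twice y∉ =
  ≡-subst (c ≈_) (substConf≡ren x y c) (EqClosure.return (rename x y twice y∉))

≈ʳ-rename : ∀ {r : Rule 𝕊} x y → occurrences x (namesRule r) ≡ 2 → y ∉ namesRule r →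
  r ≈ʳ renRule (x ↦ y) r
≈ʳ-rename {r = r} x y twice y∉ =
  ≡-subst (r ≈ʳ_) (substRule≡ren x y r) (EqClosure.return (rename x y twice y∉))

≈-rename-injective : ∀ ρ (c : PreConfiguration 𝕊) →
  InjectiveOn ρ (namesConf c) → MovesOnlyTwice ρ (namesConf c) → c ≈ renConf ρ c
≈-rename-injective = Renaming.≅-rename-injective namesConf renConf names-renConf
  (λ c agree → bindConf-cong c (cong var ∘ agree)) (λ ρ σ → bindConf-∘ (var ∘ ρ) (var ∘ σ))
  bindConf-var _≈_ ε ≈-sym _◅◅_ ≈-rename

≈ʳ-rename-injective : ∀ ρ (r : Rule 𝕊) →
  InjectiveOn ρ (namesRule r) → MovesOnlyTwice ρ (namesRule r) → r ≈ʳ renRule ρ r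
≈ʳ-rename-injective = Renaming.≅-rename-injective namesRule renRule names-renRule
  (λ r agree → bindRule-cong r (cong var ∘ agree)) (λ ρ σ → bindRule-∘ (var ∘ ρ) (var ∘ σ))
  bindRule-var _≈ʳ_ ε ≈ʳ-sym _◅◅_ ≈ʳ-rename

-- α-equivalence as a single injective renaming

-- Renaming x to y merges two names and so has no inverse. Where y does not occur, exchanging x and
-- y has the same effect and is a bijection of all names.
transpose : Name → Name → Name → Name
transpose x y z with x ≟ z | y ≟ z
... | yes _ | _     = y
... | no _  | yes _ = x
... | no _  | no _  = z

transpose-left : ∀ x y → transpose x y x ≡ y
transpose-left x y with x ≟ x
... | yes _  = ≡-refl
... | no x≢x = contradiction ≡-refl x≢x

transpose-right : ∀ x y → transpose x y y ≡ x
transpose-right x y with x ≟ y | y ≟ y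
... | yes eq | _      = sym eq
... | no _   | yes _  = ≡-refl
... | no _   | no y≢y = contradiction ≡-refl y≢y

transpose-other : ∀ {x y z} → x ≢ z → y ≢ z → transpose x y z ≡ z
transpose-other {x} {y} {z} x≢z y≢z with x ≟ z | y ≟ z
... | yes x≡z | _       = contradiction x≡z x≢z
... | no _    | yes y≡z = contradiction y≡z y≢z
... | no _    | no _    = ≡-refl

transpose-involutive : ∀ x y z → transpose x y (transpose x y z) ≡ z
transpose-involutive x y z with x ≟ z | y ≟ z
... | yes ≡-refl | _       = transpose-right x y
... | no _    | yes ≡-refl = transpose-left x y
... | no x≢z  | no y≢z  = transpose-other x≢z y≢z

transpose-injective : ∀ x y → Injective _≡_ _≡_ (transpose x y)
transpose-injective x y {a} {b} eq =
  ≡-trans (sym (transpose-involutive x y a)) (≡-trans (cong (transpose x y) eq) (transpose-involutive x y b))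

↦≡transpose : ∀ {x y z} → y ≢ z → (x ↦ y) z ≡ transpose x y z
↦≡transpose {x} {y} {z} y≢z with x ≟ z | y ≟ z
... | yes _ | _       = ≡-refl
... | no _  | yes y≡z = contradiction y≡z y≢z
... | no _  | no _    = ≡-refl

∉⇒≢ : ∀ {x y : Name} {xs} → x ∉ xs → y ∈ xs → x ≢ y
∉⇒≢ x∉ y∈ ≡-refl = x∉ y∈

substConf≡transpose : ∀ x y {c : PreConfiguration 𝕊} → y ∉ namesConf c →
  substConf x (var y) c ≡ renConf (transpose x y) c
substConf≡transpose x y {c} y∉ =
  ≡-trans (substConf≡ren x y c) (bindConf-cong c λ z∈ → cong var (↦≡transpose (∉⇒≢ y∉ z∈)))

substRule≡transpose : ∀ x y {r : Rule 𝕊} → y ∉ namesRule r →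
  substRule x (var y) r ≡ renRule (transpose x y) r
substRule≡transpose x y {r} y∉ =
  ≡-trans (substRule≡ren x y r) (bindRule-cong r λ z∈ → cong var (↦≡transpose (∉⇒≢ y∉ z∈)))

renConf-involutive : ∀ x y (c : PreConfiguration 𝕊) →
  renConf (transpose x y) (renConf (transpose x y) c) ≡ c
renConf-involutive x y c =
  ≡-trans (bindConf-∘ _ _ c)
    (≡-trans (bindConf-cong c λ {z} _ → cong var (transpose-involutive x y z)) (bindConf-var c))

renRule-involutive : ∀ x y (r : Rule 𝕊) →
  renRule (transpose x y) (renRule (transpose x y) r) ≡ r
renRule-involutive x y r =
  ≡-trans (bindRule-∘ _ _ r)
    (≡-trans (bindRule-cong r λ {z} _ → cong var (transpose-involutive x y z)) (bindRule-var r))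

occurrences-renConf : ∀ {ρ} → Injective _≡_ _≡_ ρ → ∀ z (c : PreConfiguration 𝕊) →
  occurrences (ρ z) (namesConf (renConf ρ c)) ≡ occurrences z (namesConf c)
occurrences-renConf {ρ = ρ} inj z c rewrite names-renConf ρ c = occurrences-map (namesConf c) (λ _ → inj)

∈-renConf : ∀ ρ {z} (c : PreConfiguration 𝕊) → z ∈ namesConf c → ρ z ∈ namesConf (renConf ρ c)
∈-renConf ρ c z∈ rewrite names-renConf ρ c = ∈-map⁺ ρ z∈

∈-renConf⁻ : ∀ ρ {w} (c : PreConfiguration 𝕊) → w ∈ namesConf (renConf ρ c) →
  ∃[ z ] z ∈ namesConf c × w ≡ ρ z
∈-renConf⁻ ρ c w∈ rewrite names-renConf ρ c = ∈-map⁻ ρ w∈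

∈-renRule⁻ : ∀ ρ {w} (r : Rule 𝕊) → w ∈ namesRule (renRule ρ r) →
  ∃[ z ] z ∈ namesRule r × w ≡ ρ z
∈-renRule⁻ ρ r w∈ rewrite names-renRule ρ r = ∈-map⁻ ρ w∈

-- Configurations up to the order of equations

≃-refl : {e : Equation 𝕊} → e ≃ e
≃-refl {e = t ≐ u} = same

≃-sym : {e e′ : Equation 𝕊} → e ≃ e′ → e′ ≃ e
≃-sym same = same
≃-sym flip = flip

≃-trans : {e e′ e″ : Equation 𝕊} → e ≃ e′ → e′ ≃ e″ → e ≃ e″
≃-trans same q    = q
≃-trans flip same = flip
≃-trans flip flip = same

≃-setoid : Signature → Setoid _ _
≃-setoid 𝕊 = record
  { Carrier = Equation 𝕊 ; _≈_ = _≃_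
  ; isEquivalence = record { refl = ≃-refl ; sym = ≃-sym ; trans = ≃-trans } }

bindEq-≃ : ∀ (g : Substitution 𝕊) {e e′} → e ≃ e′ → bindEq g e ≃ bindEq g e′
bindEq-≃ g same = same
bindEq-≃ g flip = flip

infix 4 _↭_

-- The reordering half of `_∼_`, separated from renaming. One constructor is enough because
-- permutations already compose.
data _↭_ {𝕊 : Signature} : PreConfiguration 𝕊 → PreConfiguration 𝕊 → Set where
  reordered : ∀ {f Δ Δ′} → Permutation _≃_ Δ Δ′ → ⟨ f ∣ Δ ⟩ ↭ ⟨ f ∣ Δ′ ⟩

↭-refl : {c : PreConfiguration 𝕊} → c ↭ c
↭-refl = reordered (refl (Pointwise.refl ≃-refl))

↭-reflexive : {c d : PreConfiguration 𝕊} → c ≡ d → c ↭ d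
↭-reflexive ≡-refl = ↭-refl

↭-sym : {c d : PreConfiguration 𝕊} → c ↭ d → d ↭ c
↭-sym (reordered p) = reordered (Perm.sym ≃-sym p)

↭-trans : {c d e : PreConfiguration 𝕊} → c ↭ d → d ↭ e → c ↭ e
↭-trans (reordered p) (reordered q) = reordered (trans p q)

↭⇒≈ : {c d : PreConfiguration 𝕊} → c ↭ d → c ≈ d
↭⇒≈ (reordered p) = EqClosure.return (reorder p)

bindConf-↭ : ∀ (g : Substitution 𝕊) {c d} → c ↭ d → bindConf g c ↭ bindConf g d
bindConf-↭ {𝕊} g (reordered p) =
  reordered (map⁺ (≃-setoid 𝕊) (bindEq-≃ g) p)
  where open SetoidPermutation (≃-setoid 𝕊) using (map⁺)

occurrences-++-comm : ∀ z xs ys → occurrences z (xs ++ ys) ≡ occurrences z (ys ++ xs)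
occurrences-++-comm z xs ys =
  ≡-trans (occurrences-++ z xs ys)
    (≡-trans (+-comm (occurrences z xs) (occurrences z ys)) (sym (occurrences-++ z ys xs)))

occurrences-≃ : ∀ z {e e′ : Equation 𝕊} → e ≃ e′ →
  occurrences z (namesEq e) ≡ occurrences z (namesEq e′)
occurrences-≃ z same = ≡-refl
occurrences-≃ z (flip {t} {u}) = occurrences-++-comm z (names t) (names u)

occurrences-permutation : ∀ z {Δ Δ′ : List (Equation 𝕊)} → Permutation _≃_ Δ Δ′ →
  occurrences z (concatMap namesEq Δ) ≡ occurrences z (concatMap namesEq Δ′)
occurrences-permutation z (refl []) = ≡-refl
occurrences-permutation z (refl (_∷_ {x = e} {y = e′} p ps)) =
  ≡-trans (occurrences-++ z (namesEq e) _)
    (≡-trans (cong₂ _+_ (occurrences-≃ z p) (occurrences-permutation z (refl ps)))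
      (sym (occurrences-++ z (namesEq e′) _)))
occurrences-permutation z (prep {x = e} {y = e′} p ps) =
  ≡-trans (occurrences-++ z (namesEq e) _)
    (≡-trans (cong₂ _+_ (occurrences-≃ z p) (occurrences-permutation z ps))
      (sym (occurrences-++ z (namesEq e′) _)))
occurrences-permutation z (swap {Δ} {Δ′} {a} {b} {a′} {b′} p q ps)
  rewrite occurrences-++ z (namesEq a) (namesEq b ++ concatMap namesEq Δ)
        | occurrences-++ z (namesEq b) (concatMap namesEq Δ)
        | occurrences-++ z (namesEq b′) (namesEq a′ ++ concatMap namesEq Δ′)
        | occurrences-++ z (namesEq a′) (concatMap namesEq Δ′)
        | occurrences-≃ z p | occurrences-≃ z q | occurrences-permutation z ps =
  x∙yz≈y∙xz (occurrences z (namesEq a′)) (occurrences z (namesEq b′)) _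
occurrences-permutation z (trans ps qs) =
  ≡-trans (occurrences-permutation z ps) (occurrences-permutation z qs)

occurrences-↭ : ∀ z {c d : PreConfiguration 𝕊} → c ↭ d →
  occurrences z (namesConf c) ≡ occurrences z (namesConf d)
occurrences-↭ z (reordered {f} p) =
  ≡-trans (occurrences-++ z (concatMap names f) _)
    (≡-trans (cong (occurrences z (concatMap names f) +_) (occurrences-permutation z p))
      (sym (occurrences-++ z (concatMap names f) _)))

-- A normal form for a chain of `_∼_` steps: one renaming followed by one reordering. Injectivity on
-- all names lets the same ρ be applied to a whole reduction step, including the names of its rule.
record Alpha {𝕊 : Signature} (c d : PreConfiguration 𝕊) : Set where
  constructor alpha
  field
    ρ         : Name → Name
    injective : Injective _≡_ _≡_ ρ
    moves     : MovesOnlyTwice ρ (namesConf c)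
    permutes  : renConf ρ c ↭ d

Alpha-trans : {c d e : PreConfiguration 𝕊} → Alpha c d → Alpha d e → Alpha c e
Alpha-trans {c = c} {d} (alpha ρ inj moves p) (alpha σ inj′ moves′ q) =
  alpha (σ ∘ ρ) (inj ∘ inj′) moves″
    (↭-trans (↭-reflexive (sym (bindConf-∘ (var ∘ σ) (var ∘ ρ) c)))
      (↭-trans (bindConf-↭ (var ∘ σ) p) q))
  where
  moves″ : MovesOnlyTwice (σ ∘ ρ) (namesConf c)
  moves″ {z} z∈ with moves z∈
  ... | inj₂ twice = inj₂ twice
  -- A name fixed by ρ occurs in d as often as in c, so the condition on σ at d carries over to c.
  ... | inj₁ ρz≡z with
      (≡-trans (sym (occurrences-renConf inj z c))
        (≡-trans (cong (λ w → occurrences w (namesConf (renConf ρ c))) ρz≡z) (occurrences-↭ z p)))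
  ... | same-occ with moves′ (∈-occurrences same-occ z∈)
  ... | inj₁ σz≡z = inj₁ (≡-trans (cong σ ρz≡z) σz≡z)
  ... | inj₂ twice = inj₂ (≡-trans same-occ twice)

Alpha-↭ : {c d : PreConfiguration 𝕊} → c ↭ d → Alpha c d
Alpha-↭ {c = c} p = alpha id id (λ _ → inj₁ ≡-refl) (↭-trans (↭-reflexive (bindConf-var c)) p)

-- Each renaming in the chain goes to a fresh name and is therefore a transposition. As a
-- transposition is its own inverse, a backward renaming is treated with the same one.
≈⇒Alpha : {c d : PreConfiguration 𝕊} → c ≈ d → Alpha c d
≈⇒Alpha ε = Alpha-↭ ↭-refl
≈⇒Alpha (fwd (reorder p) ◅ ps) = Alpha-trans (Alpha-↭ (reordered p)) (≈⇒Alpha ps)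
≈⇒Alpha (bwd (reorder p) ◅ ps) = Alpha-trans (Alpha-↭ (↭-sym (reordered p))) (≈⇒Alpha ps)
≈⇒Alpha (fwd (rename {c} x y twice y∉) ◅ ps) = Alpha-trans
  (alpha τ (transpose-injective x y) moves (↭-reflexive (sym (substConf≡transpose x y y∉))))
  (≈⇒Alpha ps)
  where
  τ = transpose x y
  moves : MovesOnlyTwice τ (namesConf c)
  moves {z} z∈ with x ≟ z
  ... | yes ≡-refl = inj₂ twice
  ... | no x≢z with y ≟ z
  ... | yes ≡-refl = contradiction z∈ y∉
  ... | no _ = inj₁ ≡-refl
≈⇒Alpha {d = d} (bwd (rename {c} x y twice y∉) ◅ ps) =
  ≡-subst (λ c′ → Alpha c′ d) (sym (substConf≡transpose x y y∉))
    (Alpha-trans (alpha τ inj moves (↭-reflexive (renConf-involutive x y c))) (≈⇒Alpha ps))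
  where
  τ = transpose x y
  inj = transpose-injective x y
  moves : MovesOnlyTwice τ (namesConf (renConf τ c))
  moves w∈ with ∈-renConf⁻ τ c w∈
  ... | z , z∈ , ≡-refl rewrite occurrences-renConf inj z c with x ≟ z
  ... | yes ≡-refl = inj₂ twice
  ... | no x≢z with y ≟ z
  ... | yes ≡-refl = contradiction z∈ y∉
  ... | no y≢z = inj₁ (transpose-other x≢z y≢z)

-- Rules up to renaming and orientation

flipRule : Rule 𝕊 → Rule 𝕊
flipRule (α [ vs ]⋈ β [ ws ]) = β [ ws ]⋈ α [ vs ]

-- Flips commute with renamings and cancel in pairs, so a chain of `_∼ʳ_` steps collapses to one
-- renaming and at most one flip.
record RuleAlpha {𝕊 : Signature} (r r′ : Rule 𝕊) : Set where
  constructor ruleAlpha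
  field
    ρ         : Name → Name
    injective : Injective _≡_ _≡_ ρ
    oriented  : r′ ≡ renRule ρ r ⊎ r′ ≡ flipRule (renRule ρ r)

RuleAlpha-flip : {r r′ : Rule 𝕊} → RuleAlpha (flipRule r) r′ → RuleAlpha r r′
RuleAlpha-flip (ruleAlpha ρ inj (inj₁ eq)) = ruleAlpha ρ inj (inj₂ eq)
RuleAlpha-flip (ruleAlpha ρ inj (inj₂ eq)) = ruleAlpha ρ inj (inj₁ eq)

RuleAlpha-ren : ∀ {r r′ : Rule 𝕊} {σ} → Injective _≡_ _≡_ σ → RuleAlpha (renRule σ r) r′ → RuleAlpha r r′
RuleAlpha-ren {r = r} {σ = σ} σ-inj (ruleAlpha ρ inj (inj₁ eq)) =
  ruleAlpha (ρ ∘ σ) (σ-inj ∘ inj) (inj₁ (≡-trans eq (bindRule-∘ (var ∘ ρ) (var ∘ σ) r)))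
RuleAlpha-ren {r = r} {σ = σ} σ-inj (ruleAlpha ρ inj (inj₂ eq)) =
  ruleAlpha (ρ ∘ σ) (σ-inj ∘ inj)
    (inj₂ (≡-trans eq (cong flipRule (bindRule-∘ (var ∘ ρ) (var ∘ σ) r))))

≈ʳ⇒RuleAlpha : {r r′ : Rule 𝕊} → r ≈ʳ r′ → RuleAlpha r r′
≈ʳ⇒RuleAlpha {r = r} ε = ruleAlpha id id (inj₁ (sym (bindRule-var r)))
≈ʳ⇒RuleAlpha (fwd flip ◅ ps) = RuleAlpha-flip (≈ʳ⇒RuleAlpha ps)
≈ʳ⇒RuleAlpha (bwd flip ◅ ps) = RuleAlpha-flip (≈ʳ⇒RuleAlpha ps)
≈ʳ⇒RuleAlpha {r′ = r′} (fwd (rename x y _ y∉) ◅ ps) =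
  RuleAlpha-ren (transpose-injective x y)
    (≡-subst (λ r₁ → RuleAlpha r₁ r′) (substRule≡transpose x y y∉) (≈ʳ⇒RuleAlpha ps))
≈ʳ⇒RuleAlpha {r′ = r′} (bwd (rename {r₁} x y _ y∉) ◅ ps) =
  RuleAlpha-ren (transpose-injective x y)
    (≡-subst (λ r₂ → RuleAlpha r₂ r′)
      (sym (≡-trans (cong (renRule (transpose x y)) (substRule≡transpose x y y∉)) (renRule-involutive x y r₁)))
      (≈ʳ⇒RuleAlpha ps))

occurrences-flipRule : ∀ x (r : Rule 𝕊) →
  occurrences x (namesRule (flipRule r)) ≡ occurrences x (namesRule r)
occurrences-flipRule x (α [ vs ]⋈ β [ ws ]) = occurrences-++-comm x (namesVec ws) (namesVec vs)

occurrences-renRule : ∀ {ρ} → Injective _≡_ _≡_ ρ → ∀ z (r : Rule 𝕊) →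
  occurrences (ρ z) (namesRule (renRule ρ r)) ≡ occurrences z (namesRule r)
occurrences-renRule {ρ = ρ} inj z r rewrite names-renRule ρ r = occurrences-map (namesRule r) (λ _ → inj)

occurrences-oriented : ∀ x {r r′ : Rule 𝕊} → r′ ≡ r ⊎ r′ ≡ flipRule r →
  occurrences x (namesRule r′) ≡ occurrences x (namesRule r)
occurrences-oriented x (inj₁ ≡-refl) = ≡-refl
occurrences-oriented x {r} (inj₂ ≡-refl) = occurrences-flipRule x r

module _ {S : InteractionSystem 𝕊} where
  open InteractionSystem S

  ∋-≈ʳ : ∀ {r r′} → S ∋ r → r ≈ʳ r′ → S ∋ r′
  ∋-≈ʳ (r₀ , isR , eq) eq′ = r₀ , isR , eq ◅◅ eq′

  -- The axiom `twice` speaks of the representatives in `isRule`. Injective renaming and flipping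
  -- preserve the counts, which extends it to every representative.
  names-twice : ∀ {r x} → S ∋ r → x ∈ namesRule r → occurrences x (namesRule r) ≡ 2
  names-twice {r} {x} (r₀ , isR , eq) x∈ with ≈ʳ⇒RuleAlpha eq
  ... | ruleAlpha ρ inj oriented
    with z , z∈ , ≡-refl ← ∈-renRule⁻ ρ r₀ (∈-occurrences (occurrences-oriented x oriented) x∈)
    with twice {r₀} {z} isR
  ... | inj₁ z∉ = contradiction z∈ z∉
  ... | inj₂ z-twice =
    ≡-trans (occurrences-oriented (ρ z) oriented) (≡-trans (occurrences-renRule inj z r₀) z-twice)

  -- Each name of a rule of the system occurs twice in it, hence may be moved.
  ∋-ren : ∀ {r ρ} → Injective _≡_ _≡_ ρ → S ∋ r → S ∋ renRule ρ r
  ∋-ren {r} {ρ} inj S∋r =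
    ∋-≈ʳ S∋r (≈ʳ-rename-injective ρ r (λ _ _ → inj) (λ z∈ → inj₂ (names-twice S∋r z∈)))

-- Names along a reduction step

map-zipWith-≐ : ∀ g (ts vs : Vec (Term 𝕊) n) →
  map (bindEq g) (toList (zipWith _≐_ ts vs)) ≡ toList (zipWith _≐_ (bindVec g ts) (bindVec g vs))
map-zipWith-≐ g []       []       = ≡-refl
map-zipWith-≐ g (t ∷ ts) (v ∷ vs) = cong (_ ∷_) (map-zipWith-≐ g ts vs)

map-pairUp : ∀ g (ts vs : Vec (Term 𝕊) m) (us ws : Vec (Term 𝕊) n) →
  map (bindEq g) (pairUp ts vs us ws) ≡
  pairUp (bindVec g ts) (bindVec g vs) (bindVec g us) (bindVec g ws)
map-pairUp g ts vs us ws =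
  ≡-trans (map-++ (bindEq g) (toList (zipWith _≐_ ts vs)) _)
    (cong₂ _++_ (map-zipWith-≐ g ts vs) (map-zipWith-≐ g us ws))

length-zipWith-≐ : ∀ (ts vs : Vec (Term 𝕊) n) → length (toList (zipWith _≐_ ts vs)) ≡ n
length-zipWith-≐ []       []       = ≡-refl
length-zipWith-≐ (t ∷ ts) (v ∷ vs) = cong suc (length-zipWith-≐ ts vs)

length-pairUp : ∀ (ts vs : Vec (Term 𝕊) m) (us ws : Vec (Term 𝕊) n) →
  length (pairUp ts vs us ws) ≡ m + n
length-pairUp ts vs us ws =
  ≡-trans (length-++ (toList (zipWith _≐_ ts vs)))
    (cong₂ _+_ (length-zipWith-≐ ts vs) (length-zipWith-≐ us ws))

occurrences-zipWith : ∀ z (ts vs : Vec (Term 𝕊) n) →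
  occurrences z (concatMap namesEq (toList (zipWith _≐_ ts vs))) ≡
  occurrences z (namesVec ts) + occurrences z (namesVec vs)
occurrences-zipWith z []       []       = ≡-refl
occurrences-zipWith z (t ∷ ts) (v ∷ vs)
  rewrite occurrences-++ z (names t ++ names v) (concatMap namesEq (toList (zipWith _≐_ ts vs)))
        | occurrences-++ z (names t) (names v)
        | occurrences-++ z (names t) (namesVec ts)
        | occurrences-++ z (names v) (namesVec vs)
        | occurrences-zipWith z ts vs =
  interchange (occurrences z (names t)) (occurrences z (names v)) (occurrences z (namesVec ts)) _

occurrences-pairUp : ∀ z (ts vs : Vec (Term 𝕊) m) (us ws : Vec (Term 𝕊) n) →
  occurrences z (concatMap namesEq (pairUp ts vs us ws)) ≡
  occurrences z (namesVec vs ++ namesVec ws) + occurrences z (namesVec ts ++ namesVec us)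
occurrences-pairUp z ts vs us ws
  rewrite concatMap-++ namesEq (toList (zipWith _≐_ ts vs)) (toList (zipWith _≐_ us ws))
        | occurrences-++ z (concatMap namesEq (toList (zipWith _≐_ ts vs)))
                           (concatMap namesEq (toList (zipWith _≐_ us ws)))
        | occurrences-++ z (namesVec vs) (namesVec ws)
        | occurrences-++ z (namesVec ts) (namesVec us)
        | occurrences-zipWith z ts vs
        | occurrences-zipWith z us ws =
  solve 4 (λ t v u w → (t :+ v) :+ (u :+ w) := (v :+ w) :+ (t :+ u)) ≡-refl
    (occurrences z (namesVec ts)) (occurrences z (namesVec vs))
    (occurrences z (namesVec us)) (occurrences z (namesVec ws))
  where open +-*-Solver

occurrences-∷ : ∀ z (f : List (Term 𝕊)) e Δ →
  occurrences z (namesConf ⟨ f ∣ e ∷ Δ ⟩) ≡ occurrences z (namesEq e) + occurrences z (namesConf ⟨ f ∣ Δ ⟩)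
occurrences-∷ z f e Δ
  rewrite occurrences-++ z (concatMap names f) (namesEq e ++ concatMap namesEq Δ)
        | occurrences-++ z (namesEq e) (concatMap namesEq Δ)
        | occurrences-++ z (concatMap names f) (concatMap namesEq Δ) =
  x∙yz≈y∙xz (occurrences z (concatMap names f)) (occurrences z (namesEq e)) _

occurrences-interaction : ∀ z (f : List (Term 𝕊)) (ts vs : Vec (Term 𝕊) m) (us ws : Vec (Term 𝕊) n) Δ →
  occurrences z (namesConf ⟨ f ∣ pairUp ts vs us ws ++ Δ ⟩) ≡
  occurrences z (namesVec vs ++ namesVec ws) +
    (occurrences z (namesVec ts ++ namesVec us) + occurrences z (namesConf ⟨ f ∣ Δ ⟩))
occurrences-interaction z f ts vs us ws Δ
  rewrite concatMap-++ namesEq (pairUp ts vs us ws) Δ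
        | occurrences-++ z (concatMap names f) (concatMap namesEq (pairUp ts vs us ws) ++ concatMap namesEq Δ)
        | occurrences-++ z (concatMap namesEq (pairUp ts vs us ws)) (concatMap namesEq Δ)
        | occurrences-pairUp z ts vs us ws
        | occurrences-++ z (concatMap names f) (concatMap namesEq Δ) =
  solve 4 (λ f r e d → f :+ ((r :+ e) :+ d) := r :+ (e :+ (f :+ d))) ≡-refl
    (occurrences z (concatMap names f)) (occurrences z (namesVec vs ++ namesVec ws))
    (occurrences z (namesVec ts ++ namesVec us)) (occurrences z (concatMap namesEq Δ))
  where open +-*-Solver

occurrences-≔ : ∀ {x z} (u : Term 𝕊) ys → x ≢ z →
  occurrences z (concatMap (names ∘ (x ≔ u)) ys) ≡
  occurrences z ys + occurrences x ys * occurrences z (names u)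
occurrences-≔ u [] x≢z = ≡-refl
occurrences-≔ {x = x} {z} u (y ∷ ys) x≢z
  with IH ← occurrences-≔ u ys x≢z | x ≟ y
... | yes ≡-refl
  rewrite occurrences-++ z (names u) (concatMap (names ∘ (x ≔ u)) ys)
        | occurrences-here x ys | occurrences-there {z} {x} ys (x≢z ∘ sym) | IH =
  x∙yz≈y∙xz (occurrences z (names u)) (occurrences z ys) _
... | no x≢y rewrite occurrences-there ys x≢y with z ≟ y
... | yes ≡-refl
  rewrite occurrences-here z (concatMap (names ∘ (x ≔ u)) ys) | occurrences-here z ys = cong suc IH
... | no z≢y
  rewrite occurrences-there (concatMap (names ∘ (x ≔ u)) ys) z≢y | occurrences-there ys z≢y = IH

∉-≔ : ∀ {x} (u : Term 𝕊) → x ∉ names u → ∀ ys → x ∉ concatMap (names ∘ (x ≔ u)) ys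
∉-≔ u x∉u [] ()
∉-≔ {x = x} u x∉u (y ∷ ys) x∈ with x ≟ y
... | yes _ with ∈-++⁻ (names u) x∈
... | inj₁ x∈u = x∉u x∈u
... | inj₂ x∈ys = ∉-≔ u x∉u ys x∈ys
∉-≔ {x = x} u x∉u (y ∷ ys) (here x≡y)  | no x≢y = x≢y x≡y
∉-≔ {x = x} u x∉u (y ∷ ys) (there x∈ys) | no x≢y = ∉-≔ u x∉u ys x∈ys

names-substConf : ∀ x (u : Term 𝕊) c →
  namesConf (substConf x u c) ≡ concatMap (names ∘ (x ≔ u)) (namesConf c)
names-substConf x u c = ≡-trans (cong namesConf (substConf≡bind x u c)) (names-bindConf (x ≔ u) c)

∉-substConf : ∀ {x} (u : Term 𝕊) c → x ∉ names u → x ∉ namesConf (substConf x u c)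
∉-substConf {x = x} u c x∉u rewrite names-substConf x u c = ∉-≔ u x∉u (namesConf c)

occurrences-substConf : ∀ {x z} (u : Term 𝕊) c → x ≢ z → occurrences x (namesConf c) ≡ 1 →
  occurrences z (namesConf (substConf x u c)) ≡ occurrences z (names u) + occurrences z (namesConf c)
occurrences-substConf {x = x} {z} u c x≢z once
  rewrite names-substConf x u c | occurrences-≔ u (namesConf c) x≢z | once
        | +-identityʳ (occurrences z (names u)) =
  +-comm (occurrences z (namesConf c)) _

module _ {S : InteractionSystem 𝕊} where
  -- An interaction keeps the old occurrences and adds the names of the rule, which are fresh and
  -- occur twice. An indirection removes both occurrences of x and merely relocates u. Preservation
  -- of linearity and `Step-moves` both follow.
  Step-occurrences : ∀ {c c′} → Step S c c′ → ∀ {z} → z ∈ namesConf c′ →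
    occurrences z (namesConf c′) ≡ 2 ⊎ occurrences z (namesConf c′) ≡ occurrences z (namesConf c)
  Step-occurrences (interaction {f} {Δ} {α} {β} {ts} {us} {vs} {ws} S∋r disjoint) {z} z∈
    rewrite occurrences-interaction z f ts vs us ws Δ
          | sym (occurrences-∷ z f (agent α ts ≐ agent β us) Δ)
    with z ∈? (namesVec vs ++ namesVec ws)
  ... | no z∉r  rewrite occurrences-∉ _ z∉r = inj₂ ≡-refl
  ... | yes z∈r
    rewrite names-twice {S = S} S∋r z∈r
          | occurrences-∉ (namesConf ⟨ f ∣ (agent α ts ≐ agent β us) ∷ Δ ⟩) (λ z∈c → disjoint (z∈r , z∈c)) =
    inj₁ ≡-refl
  Step-occurrences (indirection {f} {Δ} {x} {u} x∉u once) {z} z∈ with x ≟ z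
  ... | yes ≡-refl = contradiction z∈ (∉-substConf u ⟨ f ∣ Δ ⟩ x∉u)
  ... | no x≢z
    rewrite occurrences-∷ z f (var x ≐ u) Δ | occurrences-there (names u) (x≢z ∘ sym) =
    inj₂ (occurrences-substConf u ⟨ f ∣ Δ ⟩ x≢z once)

  -- With this, a renaming that is an α-conversion at the source of a step is one at its target as
  -- well.
  Step-moves : ∀ {c c′ ρ} → Step S c c′ →
    MovesOnlyTwice ρ (namesConf c) → MovesOnlyTwice ρ (namesConf c′)
  Step-moves step moves z∈ with Step-occurrences step z∈
  ... | inj₁ twice = inj₂ twice
  ... | inj₂ same-occ with moves (∈-occurrences same-occ z∈)
  ... | inj₁ fixed = inj₁ fixed
  ... | inj₂ twice = inj₂ (≡-trans same-occ twice)

  Step-ren : ∀ {c c′ ρ} → Injective _≡_ _≡_ ρ → Step S c c′ → Step S (renConf ρ c) (renConf ρ c′)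
  Step-ren {ρ = ρ} inj (interaction {f} {Δ} {α} {β} {ts} {us} {vs} {ws} S∋r disjoint) =
    ≡-subst (Step S (renConf ρ c)) (cong ⟨ map (bind (var ∘ ρ)) f ∣_⟩ (sym result))
      (interaction (∋-ren {S = S} inj S∋r) disjoint′)
    where
    r = α [ vs ]⋈ β [ ws ]
    c = ⟨ f ∣ (agent α ts ≐ agent β us) ∷ Δ ⟩

    result = ≡-trans (map-++ (bindEq (var ∘ ρ)) (pairUp ts vs us ws) Δ)
      (cong (_++ map (bindEq (var ∘ ρ)) Δ) (map-pairUp (var ∘ ρ) ts vs us ws))

    disjoint′ : Disjoint (namesRule (renRule ρ r)) (namesConf (renConf ρ c))
    disjoint′ (z∈r , z∈c) with ∈-renRule⁻ ρ r z∈r | ∈-renConf⁻ ρ c z∈c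
    ... | y , y∈r , ≡-refl | y′ , y′∈c , eq with inj eq
    ... | ≡-refl = disjoint (y∈r , y′∈c)
  Step-ren {ρ = ρ} inj (indirection {f} {Δ} {x} {u} x∉u once) =
    ≡-subst (Step S (renConf ρ ⟨ f ∣ (var x ≐ u) ∷ Δ ⟩)) result
      (indirection x∉u′ (≡-trans (occurrences-renConf inj x c) once))
    where
    c = ⟨ f ∣ Δ ⟩

    x∉u′ : ρ x ∉ names (bind (var ∘ ρ) u)
    x∉u′ ρx∈ rewrite names-bind (var ∘ ρ) u | concatMap-names-var 𝕊 ρ (names u)
      with ∈-map⁻ ρ ρx∈
    ... | y , y∈ , eq with inj eq
    ... | ≡-refl = x∉u y∈

    -- By injectivity the tests x = z and ρ x = ρ z have the same outcome, so renaming commutes with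
    -- the substitution made by the indirection.
    pointwise : ∀ z → bind (ρ x ≔ bind (var ∘ ρ) u) (var (ρ z)) ≡ bind (var ∘ ρ) ((x ≔ u) z)
    pointwise z with x ≟ z | ρ x ≟ ρ z
    ... | yes _ | yes _ = ≡-refl
    ... | no _  | no _  = ≡-refl
    ... | yes ≡-refl | no ρx≢ρx = contradiction ≡-refl ρx≢ρx
    ... | no x≢z | yes eq = contradiction (inj eq) x≢z

    result : substConf (ρ x) (bind (var ∘ ρ) u) (renConf ρ c) ≡ renConf ρ (substConf x u c)
    result =
      ≡-trans (substConf≡bind (ρ x) (bind (var ∘ ρ) u) (renConf ρ c))
        (≡-trans (bindConf-∘ (ρ x ≔ bind (var ∘ ρ) u) (var ∘ ρ) c)
          (≡-trans (bindConf-cong c λ {z} _ → pointwise z)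
            (≡-trans (sym (bindConf-∘ (var ∘ ρ) (x ≔ u) c))
              (cong (renConf ρ) (sym (substConf≡bind x u c))))))

-- Steps with a common source

-- A `Step` acts on the head of the list. Here the heads are a and b′, so each of two steps acts on
-- the equation that the other leaves aside.
data Crossed {𝕊 : Signature} : List (Equation 𝕊) → List (Equation 𝕊) → Set where
  crossed : ∀ {a b a′ b′} → a ≃ a′ → b ≃ b′ → Crossed (a ∷ b ∷ []) (b′ ∷ a′ ∷ [])

-- Because of `trans` a permutation cannot simply be inverted. Instead the two possible shapes are
-- composed along the derivation, two crossings cancelling.
permutation-short : {Δ Δ′ : List (Equation 𝕊)} → Permutation _≃_ Δ Δ′ → length Δ ≤ 2 →
  Pointwise _≃_ Δ Δ′ ⊎ Crossed Δ Δ′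
permutation-short (refl ps) _ = inj₁ ps
permutation-short (prep p ps) (s≤s len) with permutation-short ps (m≤n⇒m≤1+n len)
... | inj₁ qs = inj₁ (p ∷ qs)
permutation-short (prep p ps) (s≤s (s≤s ())) | inj₂ (crossed _ _)
permutation-short (swap {[]} p q ps) _ with permutation-short ps z≤n
... | inj₁ [] = inj₂ (crossed p q)
permutation-short (swap {_ ∷ _} p q ps) (s≤s (s≤s ()))
permutation-short (trans ps qs) len with permutation-short ps len
... | inj₁ rs with permutation-short qs (≡-subst (_≤ 2) (Pointwise.Pointwise-length rs) len)
... | inj₁ ss = inj₁ (Pointwise.transitive ≃-trans rs ss)
permutation-short (trans ps qs) len | inj₁ (p ∷ q ∷ []) | inj₂ (crossed p′ q′) =
  inj₂ (crossed (≃-trans p p′) (≃-trans q q′))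
permutation-short (trans ps qs) len | inj₂ (crossed p q) with permutation-short qs (s≤s (s≤s z≤n))
... | inj₁ (q′ ∷ p′ ∷ []) = inj₂ (crossed (≃-trans p p′) (≃-trans q q′))
... | inj₂ (crossed q′ p′) = inj₁ (≃-trans p p′ ∷ ≃-trans q q′ ∷ [])

SameAgents-sym : (r r′ : Rule 𝕊) → SameAgents r r′ → SameAgents r′ r
SameAgents-sym _ _ (inj₁ (p , q)) = inj₁ (sym p , sym q)
SameAgents-sym _ _ (inj₂ (p , q)) = inj₂ (sym q , sym p)

SameAgents-trans : (r r′ r″ : Rule 𝕊) → SameAgents r r′ → SameAgents r′ r″ → SameAgents r r″
SameAgents-trans _ _ _ (inj₁ (p , q)) (inj₁ (p′ , q′)) = inj₁ (≡-trans p p′ , ≡-trans q q′)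
SameAgents-trans _ _ _ (inj₁ (p , q)) (inj₂ (p′ , q′)) = inj₂ (≡-trans p p′ , ≡-trans q q′)
SameAgents-trans _ _ _ (inj₂ (p , q)) (inj₁ (p′ , q′)) = inj₂ (≡-trans p q′ , ≡-trans q p′)
SameAgents-trans _ _ _ (inj₂ (p , q)) (inj₂ (p′ , q′)) = inj₁ (≡-trans p q′ , ≡-trans q p′)

≈ʳ⇒SameAgents : {r r′ : Rule 𝕊} → r ≈ʳ r′ → SameAgents r r′
≈ʳ⇒SameAgents eq with ≈ʳ⇒RuleAlpha eq
... | ruleAlpha _ _ (inj₁ ≡-refl) = inj₁ (≡-refl , ≡-refl)
... | ruleAlpha _ _ (inj₂ ≡-refl) = inj₂ (≡-refl , ≡-refl)

pairUp-nullary : ∀ (ts vs : Vec (Term 𝕊) m) (us ws : Vec (Term 𝕊) n) →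
  m + n ≡ 0 → pairUp ts vs us ws ≡ []
pairUp-nullary ts vs us ws eq with pairUp ts vs us ws | ≡-trans (length-pairUp ts vs us ws) eq
... | [] | _ = ≡-refl

agent-injective : ∀ {α} {ts us : Vec (Term 𝕊) (ar 𝕊 α)} → agent α ts ≡ agent α us → ts ≡ us
agent-injective ≡-refl = ≡-refl

≐-∷-injective : {t t′ u u′ : Term 𝕊} {Δ Δ′ : List (Equation 𝕊)} → (t ≐ u) ∷ Δ ≡ (t′ ≐ u′) ∷ Δ′ →
  t ≡ t′ × u ≡ u′ × Δ ≡ Δ′
≐-∷-injective ≡-refl = ≡-refl , ≡-refl , ≡-refl

subst-∉ : ∀ {x} (u t : Term 𝕊) → x ∉ names t → subst x u t ≡ t
subst-∉ {x = x} u t x∉t = ≡-trans (subst≡bind x u t) (≡-trans (bind-cong t agree) (bind-var t))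
  where
  agree : AgreeOn (x ≔ u) var (names t)
  agree {y} y∈ with x ≟ y
  ... | yes ≡-refl = contradiction y∈ x∉t
  ... | no _ = ≡-refl

substConf-↭ : ∀ x (u : Term 𝕊) {c d} → c ↭ d → substConf x u c ↭ substConf x u d
substConf-↭ x u {c} {d} p rewrite substConf≡bind x u c | substConf≡bind x u d = bindConf-↭ (x ≔ u) p

-- The form in which the nonempty reduct of a clash is used. Substitution preserves it, as both
-- sides already begin with agents.
NonNullary : Equation 𝕊 → Set
NonNullary {𝕊} (agent α _ ≐ agent β _) = ar 𝕊 α + ar 𝕊 β ≢ 0
NonNullary (var _ ≐ _)          = ⊥
NonNullary (agent _ _ ≐ var _)  = ⊥

NonNullary-≃ : {e e′ : Equation 𝕊} → e ≃ e′ → NonNullary e → NonNullary e′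
NonNullary-≃ same nn = nn
NonNullary-≃ {𝕊} (flip {agent α _} {agent β _}) nn = nn ∘ ≡-trans (+-comm (ar 𝕊 α) (ar 𝕊 β))

NonNullary-bind : ∀ (g : Substitution 𝕊) e → NonNullary e → NonNullary (bindEq g e)
NonNullary-bind g (agent α _ ≐ agent β _) nn = nn

-- The shape is given by an equality so that it can be asserted of a reduct such as
-- `pairUp ts vs us ws ++ Δ`, whose list of equations is not in constructor form.
record Single {𝕊 : Signature} (c : PreConfiguration 𝕊) : Set where
  constructor single
  field
    {equation}  : Equation 𝕊
    is-single   : c ≡ ⟨ [] ∣ equation ∷ [] ⟩
    non-nullary : NonNullary equation

Single-≈ : {c d : PreConfiguration 𝕊} → c ≈ d → Single c → Single d
Single-≈ c≈d (single {e} ≡-refl nn) with ≈⇒Alpha c≈d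
... | alpha ρ _ _ (reordered p) with permutation-short p (s≤s z≤n)
... | inj₁ (q ∷ []) = single ≡-refl (NonNullary-≃ q (NonNullary-bind (var ∘ ρ) e nn))

length-Single : {f : List (Term 𝕊)} {Δ : List (Equation 𝕊)} → Single ⟨ f ∣ Δ ⟩ → length Δ ≡ 1
length-Single (single ≡-refl _) = ≡-refl

-- Every port yields one equation. Counting them bounds the equations that stand beside the active
-- pair.
interaction-Single : ∀ {f} {Δ : List (Equation 𝕊)}
  (ts vs : Vec (Term 𝕊) m) (us ws : Vec (Term 𝕊) n) →
  Single ⟨ f ∣ pairUp ts vs us ws ++ Δ ⟩ → m + n + length Δ ≡ 1
interaction-Single {Δ = Δ} ts vs us ws s =
  ≡-trans (cong (_+ length Δ) (sym (length-pairUp ts vs us ws)))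
    (≡-trans (sym (length-++ (pairUp ts vs us ws))) (length-Single s))

-- An even number that is at most 1 must be 0. Two equal agents therefore have no ports when their
-- interaction results in a single equation.
double≢1 : ∀ k l → k + k + l ≡ 1 → k + k ≡ 0
double≢1 zero    l eq = ≡-refl
double≢1 (suc k) l eq rewrite +-suc k k with () ← eq

-- In the crossed case the equation left aside by an interaction ends the reduct, so it is the one
-- equation that remains.
last-Single : ∀ {f} (Δ : List (Equation 𝕊)) {e} → Single ⟨ f ∣ Δ ++ e ∷ [] ⟩ → NonNullary e
last-Single Δ (single eq nn) =
  ≡-subst NonNullary (sym (∷ʳ-injectiveʳ Δ [] (cong PreConfiguration.equations eq))) nn

-- An equation of two agents is not of the form x = u in either orientation, so the steps act on
-- different equations. Then x = u survives the interaction as the only equation, but one of its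
-- sides is a name.
interaction-indirection : ∀ {f Δ Δ′ α β} ts us vs ws {x u} →
  Permutation _≃_ ((agent α ts ≐ agent β us) ∷ Δ) ((var x ≐ u) ∷ Δ′) →
  ¬ Single ⟨ f ∣ pairUp {𝕊} ts vs us ws ++ Δ ⟩
interaction-indirection {Δ = Δ} ts us vs ws p s
  with permutation-short p (s≤s (≤-trans (m≤n+m (length Δ) _) (≤-reflexive (interaction-Single ts vs us ws s))))
... | inj₁ (() ∷ _)
... | inj₂ (crossed _ q) = NonNullary-≃ q (last-Single (pairUp ts vs us ws) s)

-- Two interactions

module _ {S : InteractionSystem 𝕊} where
  open InteractionSystem S

  ∋-unique : ∀ {r r′} → S ∋ r → S ∋ r′ → SameAgents r r′ → r ≈ʳ r′
  ∋-unique {r} {r′} (r₀ , isR , p) (r₀′ , isR′ , q) agents =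
    ≈ʳ-sym p ◅◅ unique isR isR′ agents₀ ◅◅ q
    where
    agents₀ : SameAgents r₀ r₀′
    agents₀ = SameAgents-trans r₀ r r₀′ (≈ʳ⇒SameAgents p)
      (SameAgents-trans r r′ r₀′ agents (SameAgents-sym r₀′ r′ (≈ʳ⇒SameAgents q)))

  -- When α ≡ β, the two orientations of a rule may yield different reducts, unless α
  -- is nullary.
  interaction-unique : ∀ {α β vs ws vs′ ws′} f Δ ts us →
    let c = ⟨ f ∣ (agent α ts ≐ agent β us) ∷ Δ ⟩ in
    S ∋ (α [ vs ]⋈ β [ ws ]) → S ∋ (α [ vs′ ]⋈ β [ ws′ ]) →
    Disjoint (namesRule (α [ vs ]⋈ β [ ws ])) (namesConf c) →
    Disjoint (namesRule (α [ vs′ ]⋈ β [ ws′ ])) (namesConf c) →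
    (α ≡ β → ar 𝕊 α + ar 𝕊 β ≡ 0) →
    ⟨ f ∣ pairUp ts vs us ws ++ Δ ⟩ ≈ ⟨ f ∣ pairUp ts vs′ us ws′ ++ Δ ⟩
  interaction-unique {α} {β} {vs} {ws} {vs′} {ws′} f Δ ts us S∋r S∋r′ disjoint disjoint′ nullary
    with ≈ʳ⇒RuleAlpha (∋-unique S∋r S∋r′ (inj₁ (≡-refl , ≡-refl)))
  -- A flip that keeps the agents in place forces α ≡ β; with no ports, both reducts are
  -- `⟨ f ∣ Δ ⟩`.
  ... | ruleAlpha ρ inj (inj₂ eq)
    rewrite pairUp-nullary ts vs us ws (nullary (cong Rule.left eq))
          | pairUp-nullary ts vs′ us ws′ (nullary (cong Rule.left eq)) = ε
  ... | ruleAlpha ρ inj (inj₁ ≡-refl) =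
    ≡-subst (c₁ ≈_) renamed (≈-rename-injective σ c₁ σ-inj σ-moves)
    where
    r = α [ vs ]⋈ β [ ws ]
    c = ⟨ f ∣ (agent α ts ≐ agent β us) ∷ Δ ⟩
    c₁ = ⟨ f ∣ pairUp ts vs us ws ++ Δ ⟩

    -- The renaming ρ between the two rules may also move names of c, so it is restricted to the
    -- names of the rule.
    σ : Name → Name
    σ z with z ∈? (namesRule r)
    ... | yes _ = ρ z
    ... | no _  = z

    σ-rule : ∀ {z} → z ∈ namesRule r → σ z ≡ ρ z
    σ-rule {z} z∈r with z ∈? (namesRule r)
    ... | yes _  = ≡-refl
    ... | no z∉r = contradiction z∈r z∉r

    σ-conf : ∀ {z} → z ∈ namesConf c → σ z ≡ z
    σ-conf {z} z∈c with z ∈? (namesRule r)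
    ... | yes z∈r = contradiction (z∈r , z∈c) disjoint
    ... | no _    = ≡-refl

    fixed : renConf σ c ≡ c
    fixed = ≡-trans (bindConf-cong c (cong var ∘ σ-conf)) (bindConf-var c)

    renamed : renConf σ c₁ ≡ ⟨ f ∣ pairUp ts (bindVec (var ∘ ρ) vs) us (bindVec (var ∘ ρ) ws) ++ Δ ⟩
    renamed
      with fixed-f ← cong PreConfiguration.interface fixed
         | fixed-ts , fixed-us , fixed-Δ ← ≐-∷-injective (cong PreConfiguration.equations fixed)
      = cong₂ ⟨_∣_⟩ fixed-f
          (≡-trans (map-++ (bindEq (var ∘ σ)) (pairUp ts vs us ws) Δ)
            (cong₂ _++_
              (≡-trans (map-pairUp (var ∘ σ) ts vs us ws)
                (cong₂ _++_
                  (cong₂ (λ ts vs → toList (zipWith _≐_ ts vs)) (agent-injective fixed-ts)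
                    (bindVec-cong vs (cong var ∘ σ-rule ∘ ∈-++⁺ˡ)))
                  (cong₂ (λ us ws → toList (zipWith _≐_ us ws)) (agent-injective fixed-us)
                    (bindVec-cong ws (cong var ∘ σ-rule ∘ ∈-++⁺ʳ (namesVec vs))))))
              fixed-Δ))

    occurrences-c₁ : ∀ z → occurrences z (namesConf c₁) ≡ occurrences z (namesRule r) + occurrences z (namesConf c)
    occurrences-c₁ z = ≡-trans (occurrences-interaction z f ts vs us ws Δ)
      (cong (occurrences z (namesRule r) +_) (sym (occurrences-∷ z f (agent α ts ≐ agent β us) Δ)))

    origin : ∀ {z} → z ∈ namesConf c₁ → z ∈ namesRule r ⊎ z ∈ namesConf c
    origin {z} z∈ with z ∈? (namesRule r)
    ... | yes z∈r = inj₁ z∈r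
    ... | no z∉r  = inj₂ (∈-occurrences
      (≡-trans (occurrences-c₁ z) (cong (_+ _) (occurrences-∉ (namesRule r) z∉r))) z∈)

    σ-moves : MovesOnlyTwice σ (namesConf c₁)
    σ-moves {z} z∈ with origin z∈
    ... | inj₂ z∈c = inj₁ (σ-conf z∈c)
    ... | inj₁ z∈r = inj₂ (≡-trans (occurrences-c₁ z)
      (cong₂ _+_ (names-twice {S = S} S∋r z∈r)
        (occurrences-∉ (namesConf c) λ z∈c → disjoint (z∈r , z∈c))))

    -- Freshness of the second rule is what keeps the renamed names of the first away from c, and so
    -- makes the piecewise σ injective.
    apart : ∀ {y z} → y ∈ namesRule r → z ∈ namesConf c → σ y ≢ σ z
    apart {y} {z} y∈r z∈c eq = disjoint′
      ( ≡-subst (_∈ namesRule (renRule ρ r)) (≡-trans (sym (σ-rule y∈r)) (≡-trans eq (σ-conf z∈c)))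
          (≡-subst (ρ y ∈_) (sym (names-renRule ρ r)) (∈-map⁺ ρ y∈r))
      , z∈c)

    σ-inj : InjectiveOn σ (namesConf c₁)
    σ-inj y∈ z∈ eq with origin y∈ | origin z∈
    ... | inj₁ y∈r | inj₁ z∈r = inj (≡-trans (sym (σ-rule y∈r)) (≡-trans eq (σ-rule z∈r)))
    ... | inj₁ y∈r | inj₂ z∈c = contradiction eq (apart y∈r z∈c)
    ... | inj₂ y∈c | inj₁ z∈r = contradiction (sym eq) (apart z∈r y∈c)
    ... | inj₂ y∈c | inj₂ z∈c = ≡-trans (sym (σ-conf y∈c)) (≡-trans eq (σ-conf z∈c))

  ∋-flip : ∀ {r} → S ∋ r → S ∋ flipRule r
  ∋-flip {_ [ _ ]⋈ _ [ _ ]} S∋r = ∋-≈ʳ {S = S} S∋r (EqClosure.return flip)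

  interaction-unique-≃ : ∀ {α β α′ β′ vs ws vs′ ws′} f Δ Δ′ {ts us ts′ us′} →
    S ∋ (α [ vs ]⋈ β [ ws ]) → S ∋ (α′ [ vs′ ]⋈ β′ [ ws′ ]) →
    Disjoint (namesRule (α [ vs ]⋈ β [ ws ])) (namesConf ⟨ f ∣ (agent α ts ≐ agent β us) ∷ Δ ⟩) →
    Disjoint (namesRule (α′ [ vs′ ]⋈ β′ [ ws′ ])) (namesConf ⟨ f ∣ (agent α′ ts′ ≐ agent β′ us′) ∷ Δ′ ⟩) →
    (α ≡ β → ar 𝕊 α + ar 𝕊 β ≡ 0) →
    (agent α ts ≐ agent β us) ≃ (agent α′ ts′ ≐ agent β′ us′) → Permutation _≃_ Δ Δ′ →
    ⟨ f ∣ pairUp ts vs us ws ++ Δ ⟩ ≈ ⟨ f ∣ pairUp ts′ vs′ us′ ws′ ++ Δ′ ⟩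
  interaction-unique-≃ {vs′ = vs} {ws} f Δ Δ′ {ts} {us} S∋r S∋r′ disjoint disjoint′ nullary same p =
    interaction-unique f Δ ts us S∋r S∋r′ disjoint
      (λ { {z} (z∈r , z∈c) → disjoint′
        ( z∈r
        , ∈-occurrences (occurrences-↭ z (reordered {f = f} (prep (same {t = agent _ ts} {agent _ us}) p))) z∈c) })
      nullary
    ◅◅ ↭⇒≈ (reordered (++⁺ˡ (pairUp ts vs us ws) p))
    where open SetoidPermutation (≃-setoid 𝕊) using (++⁺ˡ)
  -- The second active pair is read backwards: its rule is flipped to match the first pair, and the
  -- two blocks of `pairUp` are exchanged afterwards.
  interaction-unique-≃ {vs′ = ws} {vs} f Δ Δ′ {ts} {us} S∋r S∋r′ disjoint disjoint′ nullary flip p =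
    interaction-unique f Δ ts us S∋r (∋-flip S∋r′) disjoint
      (λ { {z} (z∈r , z∈c) → disjoint′
        ( ∈-occurrences (occurrences-++-comm z (namesVec vs) (namesVec ws)) z∈r
        , ∈-occurrences (occurrences-↭ z (reordered {f = f} (prep (flip {t = agent _ ts} {agent _ us}) p))) z∈c) })
      nullary
    ◅◅ ↭⇒≈ (reordered (++⁺ (++-comm (toList (zipWith _≐_ ts vs)) (toList (zipWith _≐_ us ws))) p))
    where open SetoidPermutation (≃-setoid 𝕊) using (++⁺; ++-comm)

  -- In the crossed case the second active pair is the equation that remains after the first step,
  -- so it has ports. But the second step leaves an equation aside, and its single-equation reduct
  -- has no room for what those ports yield.
  interaction-interaction : ∀ {α β α′ β′ vs ws vs′ ws′} f Δ Δ′ ts us ts′ us′ →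
    S ∋ (α [ vs ]⋈ β [ ws ]) → S ∋ (α′ [ vs′ ]⋈ β′ [ ws′ ]) →
    Disjoint (namesRule (α [ vs ]⋈ β [ ws ])) (namesConf ⟨ f ∣ (agent α ts ≐ agent β us) ∷ Δ ⟩) →
    Disjoint (namesRule (α′ [ vs′ ]⋈ β′ [ ws′ ])) (namesConf ⟨ f ∣ (agent α′ ts′ ≐ agent β′ us′) ∷ Δ′ ⟩) →
    Permutation _≃_ ((agent α ts ≐ agent β us) ∷ Δ) ((agent α′ ts′ ≐ agent β′ us′) ∷ Δ′) →
    Single ⟨ f ∣ pairUp ts vs us ws ++ Δ ⟩ → Single ⟨ f ∣ pairUp ts′ vs′ us′ ws′ ++ Δ′ ⟩ →
    ⟨ f ∣ pairUp ts vs us ws ++ Δ ⟩ ≈ ⟨ f ∣ pairUp ts′ vs′ us′ ws′ ++ Δ′ ⟩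
  interaction-interaction {α} {vs = vs} {ws} {vs′} {ws′} f Δ Δ′ ts us ts′ us′
    S∋r S∋r′ disjoint disjoint′ p s s′
    with permutation-short p (s≤s (≤-trans (m≤n+m (length Δ) _) (≤-reflexive (interaction-Single ts vs us ws s))))
  ... | inj₁ (head ∷ tail) =
    interaction-unique-≃ f Δ Δ′ S∋r S∋r′ disjoint disjoint′
      (λ { ≡-refl → double≢1 (ar 𝕊 α) (length Δ) (interaction-Single ts vs us ws s) }) head (refl tail)
  ... | inj₂ (crossed _ q) =
    contradiction (+-cancelʳ-≡ 1 _ 0 (interaction-Single ts′ vs′ us′ ws′ s′))
      (NonNullary-≃ q (last-Single (pairUp ts vs us ws) s))

-- Two indirections

substConf-swap : ∀ {x y} (c : PreConfiguration 𝕊) → x ≢ y →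
  substConf y (var x) (substConf x (var y) c) ≡ substConf y (var x) c
substConf-swap {x = x} {y} c x≢y =
  ≡-trans (cong (substConf y (var x)) (substConf≡ren x y c))
    (≡-trans (substConf≡ren y x (renConf (x ↦ y) c))
      (≡-trans (bindConf-∘ (var ∘ (y ↦ x)) (var ∘ (x ↦ y)) c)
        (≡-trans (bindConf-cong c λ {z} _ → cong var (pointwise z)) (sym (substConf≡ren y x c)))))
  where
  -- Either way both x and y end up as x.
  pointwise : ∀ z → (y ↦ x) ((x ↦ y) z) ≡ (y ↦ x) z
  pointwise z with x ≟ z
  ... | yes ≡-refl = ≡-trans (↦-same y x) (sym (↦-other (x≢y ∘ sym)))
  ... | no _       = ≡-refl

subst-var : ∀ x (u : Term 𝕊) → subst x u (var x) ≡ u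
subst-var x u with x ≟ x
... | yes _  = ≡-refl
... | no x≢x = contradiction ≡-refl x≢x

substEq-≃ : ∀ x (u : Term 𝕊) {e e′} → e ≃ e′ → substEq x u e ≃ substEq x u e′
substEq-≃ x u same = same
substEq-≃ x u flip = flip

-- A name other than x would stay a name after the substitution, whereas the result has an agent on
-- the left.
substituted : ∀ {x y} (u v : Term 𝕊) → NonNullary (substEq x u (var y ≐ v)) → x ≡ y
substituted {x = x} {y} u v nn with x ≟ y
... | yes x≡y = x≡y

substEq-var : ∀ {x} (u v : Term 𝕊) → x ∉ names v → substEq x u (var x ≐ v) ≡ (u ≐ v)
substEq-var {x = x} u v x∉v = cong₂ _≐_ (subst-var x u) (subst-∉ u v x∉v)

indirection-indirection : ∀ {f Δ Δ′ x y} {u v : Term 𝕊} →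
  x ∉ names u → occurrences x (namesConf ⟨ f ∣ Δ ⟩) ≡ 1 →
  y ∉ names v → occurrences y (namesConf ⟨ f ∣ Δ′ ⟩) ≡ 1 →
  Permutation _≃_ ((var x ≐ u) ∷ Δ) ((var y ≐ v) ∷ Δ′) →
  Single (substConf x u ⟨ f ∣ Δ ⟩) →
  substConf x u ⟨ f ∣ Δ ⟩ ≈ substConf y v ⟨ f ∣ Δ′ ⟩
indirection-indirection {f = f} {Δ} {Δ′} {x} {y} {u} {v} x∉u x-once y∉v y-once p s
  with permutation-short p (s≤s (≤-reflexive (≡-trans (sym (length-map (substEq x u) Δ)) (length-Single s))))
... | inj₁ (same ∷ tail) = ↭⇒≈ (substConf-↭ x u (reordered (refl tail)))
... | inj₁ (flip ∷ tail) =
  -- After x has been eliminated, y occurs twice, once in place of x and once where it already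
  -- stood, while x has vanished. Hence y may be renamed to x.
  EqClosure.return (rename y x y-twice (∉-substConf (var y) c x∉u))
    ◅◅ ≈-reflexive (substConf-swap c x≢y)
    ◅◅ ↭⇒≈ (substConf-↭ y (var x) (reordered (refl tail)))
  where
  c = ⟨ f ∣ Δ ⟩
  x≢y = x∉u ∘ here
  y-twice : occurrences y (namesConf (substConf x (var y) c)) ≡ 2
  y-twice = ≡-trans (occurrences-substConf (var y) c x≢y x-once)
    (cong₂ _+_ (occurrences-here y []) (≡-trans (occurrences-↭ y (reordered {f = f} (refl tail))) y-once))
indirection-indirection {f = []} {x = x} {y} {u} {v} x∉u _ y∉v _ _ (single ≡-refl nn)
    | inj₂ (crossed {a′ = a′} q r)
  with substituted u v (NonNullary-≃ (substEq-≃ x u r) nn)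
-- Now the two equations are x = u and x = v up to orientation; eliminating x by the first leaves u
-- = v, by the second v = u.
... | ≡-refl = ↭⇒≈ (reordered (prep
  (≃-trans (substEq-≃ x u r)
    (≡-subst (_≃ substEq x v a′) (sym (substEq-var u v y∉v))
      (≃-trans flip
        (≡-subst (_≃ substEq x v a′) (substEq-var v u x∉u) (substEq-≃ x v q)))))
  (refl [])))

-- Uniqueness of the single-equation reduct, and the theorem

module _ {S : InteractionSystem 𝕊} where

  -- No further reduction is made to join the targets: both consist of one equation with ports,
  -- which leaves no genuine choice between the steps.
  diamond : ∀ {c c′ d d′} → Step S c c′ → Step S d d′ → c ↭ d → Single c′ → Single d′ → c′ ≈ d′
  diamond (interaction {f} {Δ} {ts = ts} {us} S∋r disjoint)
          (interaction {Δ = Δ′} {ts = ts′} {us′} S∋r′ disjoint′) (reordered p) s s′ =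
    interaction-interaction {S = S} f Δ Δ′ ts us ts′ us′ S∋r S∋r′ disjoint disjoint′ p s s′
  diamond (interaction {ts = ts} {us} {vs} {ws} _ _) (indirection _ _) (reordered p) s s′ =
    contradiction s (interaction-indirection ts us vs ws p)
  diamond (indirection _ _) (interaction {ts = ts} {us} {vs} {ws} _ _) (reordered p) s s′ =
    contradiction s′ (interaction-indirection ts us vs ws (Perm.sym ≃-sym p))
  diamond (indirection x∉u x-once) (indirection y∉v y-once) (reordered p) s s′ =
    indirection-indirection x∉u x-once y∉v y-once p s

  -- The first step is carried along the renaming part of the α-equivalence, after which the sources
  -- differ only in order. Its target changes only by an α-conversion.
  diamond-≈ : ∀ {c c′ d d′} → Step S c c′ → Step S d d′ → c ≈ d → Single c′ → Single d′ → c′ ≈ d′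
  diamond-≈ {c} {c′} step step′ c≈d s s′ with ≈⇒Alpha c≈d
  ... | alpha ρ inj moves p =
    renamed ◅◅ diamond (Step-ren {S = S} inj step) step′ p (Single-≈ renamed s) s′
    where
    renamed : c′ ≈ renConf ρ c′
    renamed = ≈-rename-injective ρ c′ (λ _ _ → inj) (Step-moves step moves)

  Step-linear : ∀ {c c′} → Step S c c′ →
    (∀ x → occurrences x (namesConf c) ≤ 2) → ∀ x → occurrences x (namesConf c′) ≤ 2
  Step-linear {c′ = c′} step linear x with x ∈? (namesConf c′)
  ... | no x∉  = ≤-trans (≤-reflexive (occurrences-∉ (namesConf c′) x∉)) z≤n
  ... | yes x∈ with Step-occurrences step x∈
  ... | inj₁ twice = ≤-reflexive twice
  ... | inj₂ eq    = ≤-trans (≤-reflexive eq) (linear x)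

  pairConf : ActivePair S → Configuration 𝕊
  pairConf p = record
    { pre    = ⟨ [] ∣ equation ∷ [] ⟩
    ; linear = λ x → ≡-subst (λ xs → occurrences x xs ≤ 2) (sym (++-identityʳ (namesEq equation))) (linear x) }
    where open ActivePair p

  ÷-step : ∀ {p : ActivePair S} {Δ} → p ÷↦ Δ → Step S (Configuration.pre (pairConf p)) ⟨ [] ∣ Δ ⟩
  ÷-step {p} (vs , ws , S∋r , disjoint , ≡-refl) =
    ≡-subst (λ Δ → Step S ⟨ [] ∣ equation ∷ [] ⟩ ⟨ [] ∣ Δ ⟩) (++-identityʳ (pairUp ts vs us ws))
      (interaction S∋r λ { {z} (z∈r , z∈c) →
        disjoint (z∈r , ≡-subst (z ∈_) (++-identityʳ (namesEq equation)) z∈c) })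
    where open ActivePair p

  reductConf : ∀ {p : ActivePair S} {Δ} → p ÷↦ Δ → Configuration 𝕊
  reductConf {p} {Δ} p÷Δ = record
    { pre    = ⟨ [] ∣ Δ ⟩
    ; linear = Step-linear (÷-step {p = p} p÷Δ) (Configuration.linear (pairConf p)) }

  ÷-Single : ∀ {p : ActivePair S} {Δ} → p ÷↦ Δ → Δ ≢ [] → Single (Configuration.pre (pairConf p))
  ÷-Single {p} (vs , ws , _ , _ , ≡-refl) Δ≢[] = single ≡-refl (Δ≢[] ∘ pairUp-nullary ts vs us ws)
    where open ActivePair p

-- A clash asserts only that Δ is nonempty; this passes the property on to Δ′.
≈-empty : {Δ : List (Equation 𝕊)} → ⟨ [] ∣ Δ ⟩ ≈ ⟨ [] ∣ [] ⟩ → Δ ≡ []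
≈-empty eq with ≈⇒Alpha (≈-sym eq)
... | alpha _ _ _ (reordered p) with permutation-short p z≤n
... | inj₁ [] = ≡-refl

proposition4 : (𝕊 : Signature) (S : InteractionSystem 𝕊) (p q : ActivePair S) →
    Different p q → Clash p q → ¬ StronglyUpwardConfluent S
proposition4 𝕊 S p q different (Δ , Δ′ , p÷Δ , q÷Δ′ , Δ≈Δ′ , Δ≢[]) confluent
  -- The common reduct is represented by Δ; the step from q arrives at Δ′, and the clash relates the
  -- two.
  with confluent (pairConf p) (pairConf q) (reductConf {p = p} p÷Δ)
         (_ , _ , ε , ÷-step {p = p} p÷Δ , ε) (_ , _ , ε , ÷-step {p = q} q÷Δ′ , ≈-sym Δ≈Δ′)
... | s , (c , c′ , s≈c , step , c′≈p) , (d , d′ , s≈d , step′ , d′≈q) =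
  -- The sources c and d are α-equivalent through s, so their targets are too, and these are p and q
  -- up to α-equivalence.
  different (≈-sym c′≈p ◅◅ diamond-≈ step step′ (≈-sym s≈c ◅◅ s≈d)
    (Single-≈ (≈-sym c′≈p) (÷-Single {p = p} p÷Δ Δ≢[]))
    (Single-≈ (≈-sym d′≈q) (÷-Single {p = q} q÷Δ′ λ { ≡-refl → Δ≢[] (≈-empty Δ≈Δ′) }))
    ◅◅ d′≈q)
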